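{- Let $n\ge3$ and $k\ge3$, and let $\ell(n,k)$ denote the maximum period of a negative orientable sequence of order $n$ over $\mathbb{Z}_k$. Then, with $s_k(n-1)$ as defined in the context, \[ \frac{s_k(n-1)}{\ell(n,k)}\rightarrow 1 \text{ as } n\rightarrow\infty \ (k \text{ fixed}),\qquad \frac{s_k(n-1)}{\ell(n,k)}\rightarrow 1 \text{ as } k\rightarrow\infty\ (n\text{ fixed}). \]
   Context: A $k$-ary sequence is a periodic sequence $S=(s_i)$ with entries in $\mathbb{Z}_k$; its period is the least positive $p$ with $s_{i+p}=s_i$ for all $i$. Write $\mathbf{s}_n(i)=(s_i,\dots,s_{i+n-1})$. $S$ is an $n$-window sequence if $\mathbf{s}_n(i)=\mathbf{s}_n(j)$ implies $i\equiv j\pmod p$. A negative orientable sequence of order $n$ is a $k$-ary $n$-window sequence with $\mathbf{s}_n(i)\neq-\mathbf{s}_n(j)^R$ for all $i,j$, where $\mathbf{u}^R$ is the reverse of $\mathbf{u}$ and negation is modulo $k$. Let $\delta=1$ if $k$ is odd and $\delta=2$ if $k$ is even, and write $n=2^tm$ with $m$ odd. Define $s_k(n-1)=\frac{k^n-\delta(n(k^{(n-1)/2}-1)+1)}{2}$ if $n$ is odd, and $s_k(n-1)=\frac{k^n - \frac{nk^{(n-2)/2}}{2}(\delta^2+k) +n\delta k^{(m-1)/2} - m\delta(k^{(m-1)/2}-1)-\delta}{2}$ if $n$ is even. -}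

module Defs where

open import Data.Nat as ℕ using (ℕ; zero; suc; _^_; _≤_; _<_; _%_; _∸_)
open import Data.Nat.Base using (_/_)
open import Data.Bool using (Bool; if_then_else_; _∧_)
open import Data.Fin using (Fin; toℕ)
open import Data.Vec using (Vec; tabulate; reverse; map)
open import Data.Integer using (+_)
open import Data.Product using (_×_; ∃-syntax)
open import Relation.Binary.PropositionalEquality using (_≡_; _≢_)
import Data.Rational as Q
open Q using (ℚ)

-- A k-ary periodic sequence is modelled as s : ℕ → ℕ with every entry < k
-- (entries in ℤ_k = {0,…,k-1}).
IsKary : ℕ → (ℕ → ℕ) → Set
IsKary k s = ∀ i → s i < k

IsPeriod : (ℕ → ℕ) → ℕ → Set
IsPeriod s p = (0 < p) × (∀ i → s (i ℕ.+ p) ≡ s i)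
             × (∀ q → 0 < q → (∀ i → s (i ℕ.+ q) ≡ s i) → p ≤ q)

window : (ℕ → ℕ) → (n : ℕ) → ℕ → Vec ℕ n
window s n i = tabulate (λ j → s (i ℕ.+ toℕ j))

negMod : ℕ → ℕ → ℕ
negMod zero    x = 0
negMod (suc k) x = (suc k ∸ x) % suc k

IsWindowSeq : ℕ → (ℕ → ℕ) → ℕ → Set
IsWindowSeq n s p = ∀ i j → window s n i ≡ window s n j → i % suc (p ∸ 1) ≡ j % suc (p ∸ 1)

IsNOS : ℕ → ℕ → (ℕ → ℕ) → ℕ → Set
IsNOS n k s p = IsKary k s × IsPeriod s p × IsWindowSeq n s p
              × (∀ i j → window s n i ≢ map (negMod k) (reverse (window s n j)))

IsMaxPeriod : ℕ → ℕ → ℕ → Set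
IsMaxPeriod n k L = (∃[ s ] IsNOS n k s L) × (∀ s p → IsNOS n k s p → p ≤ L)

-- odd part m of n (n = 2^t m); fuel n suffices for n ≥ 1
oddPartAux : ℕ → ℕ → ℕ
oddPartAux zero    x = x
oddPartAux (suc f) x = if (x % 2 ℕ.≡ᵇ 0) ∧ (0 ℕ.<ᵇ x) then oddPartAux f (x / 2) else x

oddPart : ℕ → ℕ
oddPart n = oddPartAux n n

isOdd : ℕ → Bool
isOdd n = n % 2 ℕ.≡ᵇ 1

ℕ→ℚ : ℕ → ℚ
ℕ→ℚ x = + x Q./ 1

δ : ℕ → ℕ
δ k = if isOdd k then 1 else 2

sK : ℕ → ℕ → ℚ
sK n k =
  if isOdd n
  then (ℕ→ℚ (k ^ n) Q.- ℕ→ℚ (δ k) Q.* (ℕ→ℚ n Q.* (ℕ→ℚ (k ^ ((n ∸ 1) / 2)) Q.- Q.1ℚ) Q.+ Q.1ℚ)) Q.* Q.½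
  else (ℕ→ℚ (k ^ n)
          Q.- (ℕ→ℚ n Q.* ℕ→ℚ (k ^ ((n ∸ 2) / 2)) Q.* Q.½) Q.* (ℕ→ℚ (δ k ℕ.* δ k) Q.+ ℕ→ℚ k)
          Q.+ ℕ→ℚ n Q.* ℕ→ℚ (δ k) Q.* ℕ→ℚ (k ^ ((m ∸ 1) / 2))
          Q.- ℕ→ℚ m Q.* ℕ→ℚ (δ k) Q.* (ℕ→ℚ (k ^ ((m ∸ 1) / 2)) Q.- Q.1ℚ)
          Q.- ℕ→ℚ (δ k)) Q.* Q.½
  where m = oddPart n

-- the ratio x / L (L is a period, hence positive; value at 0 irrelevant)
ratio : ℚ → ℕ → ℚ
ratio x zero    = Q.0ℚ
ratio x (suc L) = x Q.* (+ 1 Q./ suc L)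

{-# OPTIONS --safe #-}

-- Give the letters of ℤ_k weights g with g (−a) = − g a and let the weight of a string be the sum
-- of its letters' weights.  Negated reversal changes the sign of the weight, so the set X of
-- strings of positive weight never contains both u and −u^R; it is also closed under rotation.
-- Hence rotation permutes X, and since raising a letter to one of maximal weight stays inside X,
-- exchanging the successors of a∷v and t∷v fuses its cycles into a single closed walk in
-- the de Bruijn graph: a negative orientable sequence of period at least |X|.
-- With Z the number of strings of weight 0 this gives k^n − Z ≤ 2 ℓ(n,k) ≤ k^n, the upper bound
-- because the windows and their negated reversals are all distinct.  For k → ∞ take g a = 2a − k
-- (a ≠ 0), where Z ≤ 2 k^(n−1).  For n → ∞ take g (±1) = ∓1 and g = 0 elsewhere, where Z is the
-- constant coefficient of (k − 2 + x + 1/x)^n, which is o(k^n).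
module Submission where

open import Defs
open import Data.Bool using (true; false; _∧_)
open import Data.Empty using (⊥-elim)
open import Data.Fin as F using (Fin; toℕ; fromℕ; fromℕ<; opposite; combine; splitAt)
import Data.Fin.Properties as Fₚ
open import Data.Integer as ℤ using (ℤ; 0ℤ; 1ℤ; -1ℤ; _⊖_; -[1+_])
import Data.Integer.Properties as ℤₚ
open import Data.List as List using (List; []; _∷_; length; filter; allFin; cartesianProductWith)
open import Data.List.Membership.Propositional using (_∈_)
open import Data.List.Membership.Propositional.Properties
  using (∈-lookup; ∈-cartesianProductWith⁺; ∈-filter⁺; ∈-filter⁻; ∈-allFin; ∈-applyUpTo⁺)
open import Data.List.Membership.Setoid.Properties using (index-injective)
import Data.List.Properties as Listₚ
open import Data.List.Relation.Unary.All as All using (All; []; _∷_)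
import Data.List.Relation.Unary.All.Properties as Allₚ
open import Data.List.Relation.Unary.AllPairs using ([]; _∷_)
open import Data.List.Relation.Unary.Any using (here; index)
open import Data.List.Relation.Unary.Unique.Propositional using (Unique)
import Data.List.Relation.Unary.Unique.Propositional.Properties as Uniqueₚ
open import Data.Nat as ℕ using (ℕ; zero; suc; _+_; _*_; _∸_; _^_; _≤_; _/_; _%_; s≤s; z≤n; NonZero)
open import Data.Nat.DivMod
  using (m≡m%n+[m/n]*n; m%n<n; n%n≡0; m<n⇒m%n≡m; m/n*n≤m; m/n≤m; /-monoˡ-≤; m/n≡1+[m∸n]/n)
open import Data.Nat.GeneralisedArithmetic using (iterate)
open import Data.Nat.ListAction using (sum)
import Data.Nat.Properties as ℕₚ
open import Data.Nat.Tactic.RingSolver using (solve-∀)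
open import Data.Product using (_×_; _,_; ∃-syntax; proj₁; proj₂)
open import Data.Rational as ℚ using (ℚ; 0ℚ; 1ℚ; ½; mkℚ; toℚᵘ; _<_; _-_; ∣_∣)
import Data.Rational.Properties as ℚₚ
open import Data.Rational.Solver using (module +-*-Solver)
import Data.Rational.Unnormalised as ℚᵘ
import Data.Rational.Unnormalised.Properties as ℚᵘₚ
open import Data.Sum using (_⊎_; inj₁; inj₂)
open import Data.Vec as Vec using (Vec; []; _∷_; _∷ʳ_; head; tail; lookup; tabulate; reverse; replicate; toList)
import Data.Vec.Properties as Vecₚ
open import Relation.Binary.Definitions using (DecidableEquality; Tri; tri<; tri≈; tri>)
open import Relation.Binary.PropositionalEquality
open import Relation.Nullary using (¬_; Dec; yes; no)
open import Relation.Unary using (Decidable)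
open import Algebra.Properties.AbelianGroup ℤₚ.+-0-abelianGroup using (∙-cancelʳ)
open import Algebra.Properties.CommutativeSemigroup ℤₚ.+-commutativeSemigroup using (x∙yz≈y∙xz)

-- Orbits of permutations of a finite set

-- Two weights appear because neither count of ties serves both limits. Under g (±1) = ∓1 every
-- string without the letters ±1 is a tie, so for fixed n the proportion of ties is at least ((k -
-- 2)/k)^n and tends to 1 with k. For g a = 2a - k the ties are counted by solving for the first
-- letter, which bounds their proportion by 2/k whatever n is.
--
-- That the ties of the first kind are o(k^n) is shown without asymptotics. The coefficients
-- decrease away from the centre, so the j-th is at most k^n/(j + 1); and of the k^j ways to add j
-- letters, one leads through the j-th coefficient instead of a more central one. Hence j further
-- letters lower the central proportion by a fixed amount as long as it exceeds 2/(j + 1).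
--
-- Of s_k only the estimate |2 s_k - k^n| ≤ 9 n k^⌊n/2⌋ enters; the right side is of lower order
-- than k^n in both limits.

least : {P : ℕ → Set} → Decidable P → ∀ n → P n → ∃[ m ] (P m × (∀ {j} → P j → m ≤ j))
least P? zero    p = 0 , p , λ _ → z≤n
least {P} P? (suc n) p with P? 0
... | yes p₀ = 0 , p₀ , λ _ → z≤n
... | no ¬p₀ with m , pm , min ← least {λ i → P (suc i)} (λ i → P? (suc i)) n p =
  suc m , pm , λ { {zero} q → ⊥-elim (¬p₀ q) ; {suc j} q → s≤s (min q) }

lookup-injective : {A : Set} {xs : List A} → Unique xs →
  ∀ i j → List.lookup xs i ≡ List.lookup xs j → i ≡ j
lookup-injective (_  ∷ _)  F.zero    F.zero    _  = refl
lookup-injective (x∉ ∷ _)  F.zero    (F.suc j) eq = ⊥-elim (All.lookup x∉ (∈-lookup j) eq)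
lookup-injective (x∉ ∷ _)  (F.suc i) F.zero    eq = ⊥-elim (All.lookup x∉ (∈-lookup i) (sym eq))
lookup-injective (_  ∷ xs!) (F.suc i) (F.suc j) eq = cong F.suc (lookup-injective xs! i j eq)

injection⇒length≤ : {A B : Set} {xs : List A} {ys : List B} (f : A → B) → Unique xs →
  (∀ {x y} → x ∈ xs → y ∈ xs → f x ≡ f y → x ≡ y) →
  (∀ {x} → x ∈ xs → f x ∈ ys) → length xs ≤ length ys
injection⇒length≤ {xs = xs} f xs! inj into = Fₚ.injective⇒≤ {f = λ i → index (into (∈-lookup {xs = xs} i))}
  λ {i} {j} eq → lookup-injective xs! i j
    (inj (∈-lookup i) (∈-lookup j) (index-injective (setoid _) (into (∈-lookup i)) (into (∈-lookup j)) eq))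

module _ {A : Set} (σ : A → A) where

  iterate-+ : ∀ i j x → iterate σ x (i + j) ≡ iterate σ (iterate σ x i) j
  iterate-+ zero    j x = refl
  iterate-+ (suc i) j x = iterate-+ i j (σ x)

  iterate-fix : ∀ m {p x} → iterate σ x p ≡ x → iterate σ x (m * p) ≡ x
  iterate-fix zero    eq = refl
  iterate-fix (suc m) {p} {x} eq = trans (iterate-+ p (m * p) x)
    (trans (cong (λ y → iterate σ y (m * p)) eq) (iterate-fix m eq))

  iterate-% : ∀ i {p x} .{{_ : NonZero p}} → iterate σ x p ≡ x → iterate σ x (i % p) ≡ iterate σ x i
  iterate-% i {p} {x} eq = sym (begin
    iterate σ x i                               ≡⟨ cong (iterate σ x) (trans (m≡m%n+[m/n]*n i p) (ℕₚ.+-comm (i % p) _)) ⟩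
    iterate σ x ((i / p) * p + i % p)           ≡⟨ iterate-+ ((i / p) * p) (i % p) x ⟩
    iterate σ (iterate σ x ((i / p) * p)) (i % p) ≡⟨ cong (λ y → iterate σ y (i % p)) (iterate-fix (i / p) eq) ⟩
    iterate σ x (i % p)                         ∎)
    where open ≡-Reasoning

  module _ (σ-injective : ∀ {x y} → σ x ≡ σ y → x ≡ y) where

    iterate-injective : ∀ i {x y} → iterate σ x i ≡ iterate σ y i → x ≡ y
    iterate-injective zero    eq = eq
    iterate-injective (suc i) eq = σ-injective (iterate-injective i eq)

    iterate-cancel : ∀ i d {x} → iterate σ x i ≡ iterate σ x (i + d) → iterate σ x d ≡ x
    iterate-cancel i d {x} eq = sym (iterate-injective i (trans eq
      (trans (cong (iterate σ x) (ℕₚ.+-comm i d)) (iterate-+ d i x))))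

-- Forward reachability. For a permutation of a finite set it is symmetric (`leads-sym`), so its
-- classes are the cycles.
Leads : {A : Set} → (A → A) → A → A → Set
Leads σ x y = ∃[ i ] iterate σ x i ≡ y

module _ {A : Set} {σ : A → A} where

  leads-refl : ∀ {x} → Leads σ x x
  leads-refl = 0 , refl

  leads-step : ∀ {x} → Leads σ x (σ x)
  leads-step = 1 , refl

  leads-trans : ∀ {x y z} → Leads σ x y → Leads σ y z → Leads σ x z
  leads-trans (i , refl) (j , refl) = i + j , iterate-+ σ i j _

leads-map : {A : Set} {σ τ : A → A} → (∀ z → Leads τ z (σ z)) → ∀ {x y} → Leads σ x y → Leads τ x y
leads-map {A} {σ} {τ} h (i , eq) = go i eq
  where
  go : ∀ i {x y} → iterate σ x i ≡ y → Leads τ x y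
  go zero    refl = leads-refl
  go (suc i) eq   = leads-trans (h _) (go i eq)

module FinitePermutation {A : Set} (_≟_ : DecidableEquality A) {N : ℕ} (code : A → Fin N)
  (code-injective : ∀ {x y} → code x ≡ code y → x ≡ y) where

  module Orbit (σ : A → A) (σ-injective : ∀ {x y} → σ x ≡ σ y → x ≡ y) where

    -- By pigeonhole two of the first N + 1 iterates coincide, and injectivity cancels their common
    -- initial steps.
    returns : ∀ x → ∃[ p ] iterate σ x (suc p) ≡ x
    returns x with i , j , i<j , eq ← Fₚ.pigeonhole (ℕₚ.n<1+n N) (λ i → code (iterate σ x (toℕ i)))
              with d , j≡ ← ℕₚ.m≤n⇒∃[o]m+o≡n i<j =
      d , iterate-cancel σ σ-injective (toℕ i) (suc d)
            (trans (code-injective eq) (cong (iterate σ x) (trans (sym j≡) (sym (ℕₚ.+-suc (toℕ i) d)))))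

    leads-sym : ∀ {x y} → Leads σ x y → Leads σ y x
    leads-sym {x} (i , refl) with p , eq ← returns x =
      -- One return takes `suc p` steps, so `i * p` steps after the first `i` complete exactly `i`
      -- returns.
      i * p , trans (sym (iterate-+ σ i (i * p) x))
                (trans (cong (iterate σ x) (sym (ℕₚ.*-suc i p))) (iterate-fix σ i eq))

    leads? : ∀ x y → Dec (Leads σ x y)
    leads? x y with p , eq ← returns x with Fₚ.any? {suc p} (λ i → iterate σ x (toℕ i) ≟ y)
    ... | yes (i , e) = yes (toℕ i , e)
    ... | no  ¬e      = no λ { (i , e) → ¬e (fromℕ< (m%n<n i (suc p)) ,
            trans (cong (iterate σ x) (Fₚ.toℕ-fromℕ< (m%n<n i (suc p)))) (trans (iterate-% σ i eq) e)) }

    order : ∀ x → ∃[ p ] (iterate σ x (suc p) ≡ x × (∀ {q} → iterate σ x (suc q) ≡ x → p ≤ q))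
    order x with p , eq ← returns x = least (λ q → iterate σ x (suc q) ≟ x) p eq

    module _ {x p} (eq : iterate σ x (suc p) ≡ x) (min : ∀ {q} → iterate σ x (suc q) ≡ x → p ≤ q) where

      private
        ¬<  : ∀ {i j} → i ℕ.< j → j ℕ.< suc p → ¬ iterate σ x i ≡ iterate σ x j
        ¬< {i} i<j j≤p e with d , refl ← ℕₚ.m≤n⇒∃[o]m+o≡n i<j =
          ℕₚ.<⇒≱ (ℕₚ.≤-trans (s≤s (ℕₚ.m≤n+m d i)) (ℕ.s≤s⁻¹ j≤p))
            (min (iterate-cancel σ σ-injective i (suc d)
              (trans e (cong (iterate σ x) (sym (ℕₚ.+-suc i d))))))

        <-unique : ∀ {i j} → i ℕ.< suc p → j ℕ.< suc p → iterate σ x i ≡ iterate σ x j → i ≡ j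
        <-unique {i} {j} i<p j<p e with ℕₚ.<-cmp i j
        ... | tri< i<j _ _ = ⊥-elim (¬< i<j j<p e)
        ... | tri≈ _ i≡j _ = i≡j
        ... | tri> _ _ j<i = ⊥-elim (¬< j<i i<p (sym e))

      iterate-≡⇒%-≡ : ∀ i j → iterate σ x i ≡ iterate σ x j → i % suc p ≡ j % suc p
      iterate-≡⇒%-≡ i j e = <-unique (m%n<n i (suc p)) (m%n<n j (suc p))
        (trans (iterate-% σ i eq) (trans e (sym (iterate-% σ j eq))))

  -- If e and f lie on different cycles of σ, exchanging their successors fuses the two cycles.
  module _ (e f : A) where

    swap : (A → A) → A → A
    swap σ z with z ≟ e | z ≟ f
    ... | yes _ | _     = σ f
    ... | no _  | yes _ = σ e
    ... | no _  | no _  = σ z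

    swap-e : ∀ σ → swap σ e ≡ σ f
    swap-e σ with e ≟ e | e ≟ f
    ... | yes _  | _ = refl
    ... | no e≢e | _ = ⊥-elim (e≢e refl)

    swap-f : ∀ σ → swap σ f ≡ σ e
    swap-f σ with f ≟ e | f ≟ f
    ... | yes refl | _      = refl
    ... | no _     | yes _  = refl
    ... | no _     | no f≢f = ⊥-elim (f≢f refl)

    swap-other : ∀ σ {z} → z ≢ e → z ≢ f → swap σ z ≡ σ z
    swap-other σ {z} z≢e z≢f with z ≟ e | z ≟ f
    ... | yes z≡e | _       = ⊥-elim (z≢e z≡e)
    ... | no _    | yes z≡f = ⊥-elim (z≢f z≡f)
    ... | no _    | no _    = refl

    swap-injective : ∀ {σ} → (∀ {x y} → σ x ≡ σ y → x ≡ y) → ∀ {x y} → swap σ x ≡ swap σ y → x ≡ y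
    swap-injective inj {x} {y} eq with x ≟ e | x ≟ f | y ≟ e | y ≟ f
    ... | yes refl | _        | yes refl | _        = refl
    ... | yes refl | _        | no y≢e   | yes refl = sym (inj eq)
    ... | yes refl | _        | no y≢e   | no y≢f   = ⊥-elim (y≢f (sym (inj eq)))
    ... | no x≢e   | yes refl | yes refl | _        = sym (inj eq)
    ... | no x≢e   | yes refl | no y≢e   | yes refl = refl
    ... | no x≢e   | yes refl | no y≢e   | no y≢f   = ⊥-elim (y≢e (sym (inj eq)))
    ... | no x≢e   | no x≢f   | yes refl | _        = ⊥-elim (x≢f (inj eq))
    ... | no x≢e   | no x≢f   | no y≢e   | yes refl = ⊥-elim (x≢e (inj eq))
    ... | no x≢e   | no x≢f   | no y≢e   | no y≢f   = inj eq

    module _ {σ : A → A} (σ-injective : ∀ {x y} → σ x ≡ σ y → x ≡ y) (e↛f : ¬ Leads σ e f) where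

      open Orbit (swap σ) (swap-injective σ-injective) using (leads-sym)
      open Orbit σ σ-injective using (returns) renaming (leads-sym to leads-symσ)

      private
        -- A cycle that e does not lead to never meets e, so on it `swap σ` agrees with `σ` until f
        -- is met.
        reach-f : ∀ j {y} → ¬ Leads σ e y → iterate σ y j ≡ f → Leads (swap σ) y f
        reach-f zero    e↛y eq = 0 , eq
        reach-f (suc j) {y} e↛y eq with y ≟ f
        ... | yes y≡f = 0 , y≡f
        ... | no  y≢f = leads-trans (1 , swap-other σ (λ { refl → e↛y leads-refl }) y≢f)
                          (reach-f j (λ e→σy → e↛y (leads-trans e→σy (leads-symσ leads-step))) eq)

      swap-joins : Leads (swap σ) e f
      swap-joins with p , eq ← returns f = leads-trans (1 , swap-e σ)
        (reach-f p (λ e→σf → e↛f (leads-trans e→σf (leads-symσ leads-step))) eq)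

      -- Only the steps out of e and f change. From e the old successor is reached by way of f, and
      -- from f by way of e, since both now share a cycle.
      swap-coarsens : ∀ z → Leads (swap σ) z (σ z)
      swap-coarsens z = helper (z ≟ e) (z ≟ f)
        where
        helper : Dec (z ≡ e) → Dec (z ≡ f) → Leads (swap σ) z (σ z)
        helper (yes refl) _          = leads-trans swap-joins (1 , swap-f σ)
        helper (no _)     (yes refl) = leads-trans (leads-sym swap-joins) (1 , swap-e σ)
        helper (no z≢e)   (no z≢f)   = 1 , swap-other σ z≢e z≢f

  module Joining (R : A → A → Set) where

    record Walk : Set where
      field
        next           : A → A
        next-injective : ∀ {x y} → next x ≡ next y → x ≡ y
        next-allowed   : ∀ x → R x (next x)
    open Walk public

    -- The condition under which an exchange of successors keeps both steps allowed.
    Twin : A → A → Set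
    Twin e f = (∀ {z} → R e z → R f z) × (∀ {z} → R f z → R e z)

    _⊑_ : Walk → Walk → Set
    w ⊑ w′ = ∀ {x y} → Leads (next w) x y → Leads (next w′) x y

    join : ∀ w {e f} → Twin e f → ∃[ w′ ] (w ⊑ w′ × Leads (next w′) e f)
    join w {e} {f} (e⇒f , f⇒e) with Orbit.leads? (next w) (next-injective w) e f
    -- On a common cycle an exchange of successors would split the cycle, so the walk is kept.
    ... | yes e→f = w , (λ l → l) , e→f
    ... | no  e↛f = record
        { next           = swap e f (next w)
        ; next-injective = swap-injective e f (next-injective w)
        ; next-allowed   = allowed
        }
      , leads-map (swap-coarsens e f (next-injective w) e↛f)
      , swap-joins e f (next-injective w) e↛f
      where
      allowed : ∀ x → R x (swap e f (next w) x)
      allowed x with x ≟ e | x ≟ f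
      ... | yes refl | _        = f⇒e (next-allowed w f)
      ... | no _     | yes refl = e⇒f (next-allowed w e)
      ... | no _     | no _     = next-allowed w x

    -- Every join only merges cycles, so links made earlier survive the later joins; this is what
    -- `⊑` records.
    joinAll : ∀ w (parent : A → A) {xs} → All (λ x → Twin x (parent x)) xs →
      ∃[ w′ ] (w ⊑ w′ × All (λ x → Leads (next w′) x (parent x)) xs)
    joinAll w parent []       = w , (λ l → l) , []
    joinAll w parent (t ∷ ts) with w₁ , w⊑w₁ , l  ← join w t
                              with w₂ , w₁⊑w₂ , ls ← joinAll w₁ parent ts =
      w₂ , (λ l → w₁⊑w₂ (w⊑w₁ l)) , w₁⊑w₂ l ∷ ls

-- Strings, weights and the construction of negative orientable sequences

module _ {A : Set} {P : A → Set} (P? : Decidable P) where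

  length-filter-∷ : ∀ x xs → length (filter P? xs) ≤ length (filter P? (x ∷ xs))
  length-filter-∷ x xs with P? x
  ... | yes _ = ℕₚ.n≤1+n _
  ... | no _  = ℕₚ.≤-refl

  length-filter-accept : ∀ {x} xs → P x → suc (length (filter P? xs)) ≤ length (filter P? (x ∷ xs))
  length-filter-accept xs px = ℕₚ.≤-reflexive (cong length (sym (Listₚ.filter-accept P? px)))

length≤filters : {A : Set} {P Q R : A → Set} (P? : Decidable P) (Q? : Decidable Q) (R? : Decidable R) →
  (∀ x → P x ⊎ Q x ⊎ R x) → ∀ xs →
  length xs ≤ length (filter P? xs) + (length (filter Q? xs) + length (filter R? xs))
length≤filters P? Q? R? cover []       = z≤n
length≤filters P? Q? R? cover (x ∷ xs) with cover x | s≤s (length≤filters P? Q? R? cover xs)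
... | inj₁ px        | ih = ℕₚ.≤-trans ih (ℕₚ.+-mono-≤ (length-filter-accept P? xs px)
  (ℕₚ.+-mono-≤ (length-filter-∷ Q? x xs) (length-filter-∷ R? x xs)))
... | inj₂ (inj₁ qx) | ih = ℕₚ.≤-trans ih (ℕₚ.≤-trans (ℕₚ.≤-reflexive (sym (ℕₚ.+-suc _ _)))
  (ℕₚ.+-mono-≤ (length-filter-∷ P? x xs) (ℕₚ.+-mono-≤ (length-filter-accept Q? xs qx) (length-filter-∷ R? x xs))))
... | inj₂ (inj₂ rx) | ih = ℕₚ.≤-trans ih (ℕₚ.≤-trans
  (ℕₚ.≤-reflexive (trans (sym (ℕₚ.+-suc (length (filter P? xs)) _))
    (cong (length (filter P? xs) +_) (sym (ℕₚ.+-suc (length (filter Q? xs)) _)))))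
  (ℕₚ.+-mono-≤ (length-filter-∷ P? x xs) (ℕₚ.+-mono-≤ (length-filter-∷ Q? x xs) (length-filter-accept R? xs rx))))

strings : ∀ k n → List (Vec (Fin k) n)
strings k zero    = [] ∷ []
strings k (suc n) = cartesianProductWith _∷_ (allFin k) (strings k n)

∈-strings : ∀ {k n} (v : Vec (Fin k) n) → v ∈ strings k n
∈-strings []      = here refl
∈-strings (a ∷ v) = ∈-cartesianProductWith⁺ _∷_ (∈-allFin a) (∈-strings v)

strings-unique : ∀ k n → Unique (strings k n)
strings-unique k zero    = [] ∷ []
strings-unique k (suc n) = Uniqueₚ.cartesianProductWith⁺ _∷_ Vecₚ.∷-injective (Uniqueₚ.allFin⁺ k) (strings-unique k n)

length-cartesianProductWith : {A B C : Set} (f : A → B → C) (xs : List A) (ys : List B) →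
  length (cartesianProductWith f xs ys) ≡ length xs * length ys
length-cartesianProductWith f []       ys = refl
length-cartesianProductWith f (x ∷ xs) ys = trans (Listₚ.length-++ (List.map (f x) ys))
  (cong₂ _+_ (Listₚ.length-map (f x) ys) (length-cartesianProductWith f xs ys))

length-strings : ∀ k n → length (strings k n) ≡ k ^ n
length-strings k zero    = refl
length-strings k (suc n) = trans (length-cartesianProductWith _∷_ (allFin k) (strings k n))
  (cong₂ _*_ (Listₚ.length-tabulate {n = k} (λ i → i)) (length-strings k n))

code : ∀ {k n} → Vec (Fin k) n → Fin (k ^ n)
code []      = F.zero
code (a ∷ v) = combine a (code v)

code-injective : ∀ {k n} {v w : Vec (Fin k) n} → code v ≡ code w → v ≡ w
code-injective {v = []}    {[]}    _  = refl
code-injective {v = a ∷ v} {b ∷ w} eq with a≡b , cv≡cw ← Fₚ.combine-injective a (code v) b (code w) eq =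
  cong₂ _∷_ a≡b (code-injective cv≡cw)

map-toℕ-injective : ∀ {k n} {v w : Vec (Fin k) n} → Vec.map toℕ v ≡ Vec.map toℕ w → v ≡ w
map-toℕ-injective {v = []}    {[]}    _  = refl
map-toℕ-injective {v = a ∷ v} {b ∷ w} eq with a≡b , v≡w ← Vecₚ.∷-injective eq =
  cong₂ _∷_ (Fₚ.toℕ-injective a≡b) (map-toℕ-injective v≡w)

-- Reflecting the nonzero letters by `opposite` sends a to k - a, so that involutivity is
-- structural; `toℕ-neg` identifies the result with `negMod`.
neg : ∀ {k} → Fin k → Fin k
neg F.zero    = F.zero
neg (F.suc i) = F.suc (opposite i)

neg-involutive : ∀ {k} (a : Fin k) → neg (neg a) ≡ a
neg-involutive F.zero    = refl
neg-involutive (F.suc i) = cong F.suc (Fₚ.opposite-involutive i)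

toℕ-neg : ∀ {k} (a : Fin k) → toℕ (neg a) ≡ negMod k (toℕ a)
toℕ-neg {suc r} F.zero    = sym (n%n≡0 (suc r))
toℕ-neg {suc r} (F.suc i) = begin
  suc (toℕ (opposite i))     ≡⟨ cong suc (Fₚ.opposite-prop i) ⟩
  suc (r ∸ suc (toℕ i))      ≡⟨ sym (ℕₚ.+-∸-assoc 1 (Fₚ.toℕ<n i)) ⟩
  r ∸ toℕ i                  ≡⟨ m<n⇒m%n≡m (s≤s (ℕₚ.m∸n≤m r (toℕ i))) ⟨
  (r ∸ toℕ i) % suc r        ∎
  where open ≡-Reasoning

map-neg-injective : ∀ {k n} {v w : Vec (Fin k) n} → Vec.map neg v ≡ Vec.map neg w → v ≡ w
map-neg-injective {v = v} {w} eq = begin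
  v                          ≡⟨ involutive v ⟨
  Vec.map neg (Vec.map neg v) ≡⟨ cong (Vec.map neg) eq ⟩
  Vec.map neg (Vec.map neg w) ≡⟨ involutive w ⟩
  w                          ∎
  where
  open ≡-Reasoning
  involutive : ∀ {k n} (v : Vec (Fin k) n) → Vec.map neg (Vec.map neg v) ≡ v
  involutive []      = refl
  involutive (a ∷ v) = cong₂ _∷_ (neg-involutive a) (involutive v)

map-negMod : ∀ {k n} (v : Vec (Fin k) n) →
  Vec.map (negMod k) (reverse (Vec.map toℕ v)) ≡ Vec.map toℕ (Vec.map neg (reverse v))
map-negMod {k} v = begin
  Vec.map (negMod k) (reverse (Vec.map toℕ v))  ≡⟨ cong (Vec.map (negMod k)) (Vecₚ.map-reverse toℕ v) ⟨
  Vec.map (negMod k) (Vec.map toℕ (reverse v))  ≡⟨ Vecₚ.map-∘ (negMod k) toℕ (reverse v) ⟨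
  Vec.map (λ a → negMod k (toℕ a)) (reverse v)  ≡⟨ Vecₚ.map-cong toℕ-neg (reverse v) ⟨
  Vec.map (λ a → toℕ (neg a)) (reverse v)       ≡⟨ Vecₚ.map-∘ toℕ neg (reverse v) ⟩
  Vec.map toℕ (Vec.map neg (reverse v))         ∎
  where open ≡-Reasoning

-- Upper bound: windows and their negated reversals

NOS-period-bound : ∀ {n k s p} → IsNOS n k s p → 2 * p ≤ k ^ n
NOS-period-bound {n} {k} {s} {suc p} (kary , period , win , nos) =
  subst (_≤ k ^ n) (cong (λ x → suc p + x) (sym (ℕₚ.+-identityʳ (suc p))))
    (Fₚ.injective⇒≤ {f = λ i → code (word (splitAt (suc p) i))}
      λ {i} {j} eq → trans (sym (Fₚ.join-splitAt (suc p) (suc p) i))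
        (trans (cong (F.join (suc p) (suc p)) (word-injective (splitAt (suc p) i) (splitAt (suc p) j) (code-injective eq)))
               (Fₚ.join-splitAt (suc p) (suc p) j)))
  where
  win-Fin : ℕ → Vec (Fin k) n
  win-Fin i = tabulate (λ j → fromℕ< (kary (i + toℕ j)))

  map-win-Fin : ∀ i → Vec.map toℕ (win-Fin i) ≡ window s n i
  map-win-Fin i = trans (sym (Vecₚ.tabulate-∘ toℕ (λ j → fromℕ< (kary (i + toℕ j)))))
    (Vecₚ.tabulate-cong (λ j → Fₚ.toℕ-fromℕ< (kary (i + toℕ j))))

  word : Fin (suc p) ⊎ Fin (suc p) → Vec (Fin k) n
  word (inj₁ i) = win-Fin (toℕ i)
  word (inj₂ i) = Vec.map neg (reverse (win-Fin (toℕ i)))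

  distinct : ∀ {i j : Fin (suc p)} → win-Fin (toℕ i) ≡ win-Fin (toℕ j) → i ≡ j
  distinct {i} {j} eq = Fₚ.toℕ-injective (begin
    toℕ i           ≡⟨ m<n⇒m%n≡m (Fₚ.toℕ<n i) ⟨
    toℕ i % suc p   ≡⟨ win (toℕ i) (toℕ j) (trans (sym (map-win-Fin (toℕ i)))
                        (trans (cong (Vec.map toℕ) eq) (map-win-Fin (toℕ j)))) ⟩
    toℕ j % suc p   ≡⟨ m<n⇒m%n≡m (Fₚ.toℕ<n j) ⟩
    toℕ j           ∎)
    where open ≡-Reasoning

  separate : ∀ i j → win-Fin i ≢ Vec.map neg (reverse (win-Fin j))
  separate i j eq = nos i j (begin
    window s n i                                            ≡⟨ map-win-Fin i ⟨
    Vec.map toℕ (win-Fin i)                                 ≡⟨ cong (Vec.map toℕ) eq ⟩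
    Vec.map toℕ (Vec.map neg (reverse (win-Fin j)))         ≡⟨ map-negMod (win-Fin j) ⟨
    Vec.map (negMod k) (reverse (Vec.map toℕ (win-Fin j)))  ≡⟨ cong (λ v → Vec.map (negMod k) (reverse v)) (map-win-Fin j) ⟩
    Vec.map (negMod k) (reverse (window s n j))             ∎)
    where open ≡-Reasoning

  word-injective : ∀ x y → word x ≡ word y → x ≡ y
  word-injective (inj₁ i) (inj₁ j) eq = cong inj₁ (distinct eq)
  word-injective (inj₁ i) (inj₂ j) eq = ⊥-elim (separate _ _ eq)
  word-injective (inj₂ i) (inj₁ j) eq = ⊥-elim (separate _ _ (sym eq))
  word-injective (inj₂ i) (inj₂ j) eq = cong inj₂ (distinct (Vecₚ.reverse-injective (map-neg-injective eq)))
NOS-period-bound {p = zero} _ = z≤n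

-- Odd letter weights and the strings of positive weight

module Weighted {k} (g : Fin k → ℤ) (g-neg : ∀ a → g (neg a) ≡ ℤ.- g a) where

  weight : ∀ {n} → Vec (Fin k) n → ℤ
  weight []      = 0ℤ
  weight (a ∷ v) = g a ℤ.+ weight v

  weight-∷ʳ : ∀ {n} (v : Vec (Fin k) n) a → weight (v ∷ʳ a) ≡ g a ℤ.+ weight v
  weight-∷ʳ []      a = refl
  weight-∷ʳ (b ∷ v) a = trans (cong (λ z → g b ℤ.+ z) (weight-∷ʳ v a)) (x∙yz≈y∙xz (g b) (g a) (weight v))

  weight-reverse : ∀ {n} (v : Vec (Fin k) n) → weight (reverse v) ≡ weight v
  weight-reverse []      = refl
  weight-reverse (a ∷ v) = begin
    weight (reverse (a ∷ v))     ≡⟨ cong weight (Vecₚ.reverse-∷ a v) ⟩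
    weight (reverse v ∷ʳ a)      ≡⟨ weight-∷ʳ (reverse v) a ⟩
    g a ℤ.+ weight (reverse v)   ≡⟨ cong (λ z → g a ℤ.+ z) (weight-reverse v) ⟩
    g a ℤ.+ weight v             ∎
    where open ≡-Reasoning

  weight-neg : ∀ {n} (v : Vec (Fin k) n) → weight (Vec.map neg v) ≡ ℤ.- weight v
  weight-neg []      = refl
  weight-neg (a ∷ v) = trans (cong₂ ℤ._+_ (g-neg a) (weight-neg v)) (sym (ℤₚ.neg-distrib-+ (g a) (weight v)))

  positives : ∀ n → List (Vec (Fin k) n)
  positives n = filter (λ v → 0ℤ ℤₚ.<? weight v) (strings k n)

  ties : ∀ n → List (Vec (Fin k) n)
  ties n = filter (λ v → weight v ℤₚ.≟ 0ℤ) (strings k n)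

  private
    negatives : ∀ n → List (Vec (Fin k) n)
    negatives n = filter (λ v → weight v ℤₚ.<? 0ℤ) (strings k n)

    -- Letterwise negation, without reversal, already changes the sign of the weight.
    negatives≤positives : ∀ n → length (negatives n) ≤ length (positives n)
    negatives≤positives n = injection⇒length≤ (Vec.map neg) (Uniqueₚ.filter⁺ _ (strings-unique k n))
      (λ _ _ → map-neg-injective)
      (λ {v} v∈ → ∈-filter⁺ _ (∈-strings (Vec.map neg v))
        (subst (0ℤ ℤ.<_) (sym (weight-neg v)) (ℤₚ.neg-mono-<
          (proj₂ (∈-filter⁻ (λ v → weight v ℤₚ.<? 0ℤ) {xs = strings k n} v∈)))))

  k^n≤2positives+ties : ∀ n → k ^ n ≤ 2 * length (positives n) + length (ties n)
  k^n≤2positives+ties n = begin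
    k ^ n                                     ≡⟨ length-strings k n ⟨
    length (strings k n)                      ≤⟨ length≤filters (λ v → weight v ℤₚ.<? 0ℤ) (λ v → weight v ℤₚ.≟ 0ℤ)
                                                   (λ v → 0ℤ ℤₚ.<? weight v) (λ v → signs v (ℤₚ.<-cmp (weight v) 0ℤ))
                                                   (strings k n) ⟩
    length (negatives n) + (length (ties n) + length (positives n))
                                              ≤⟨ ℕₚ.+-monoˡ-≤ _ (negatives≤positives n) ⟩
    P + (T + P)                               ≡⟨ cong (P +_) (trans (ℕₚ.+-comm T P) (cong (_+ T) (sym (ℕₚ.+-identityʳ P)))) ⟩
    P + (P + 0 + T)                           ≡⟨ ℕₚ.+-assoc P (P + 0) T ⟨
    2 * P + T                                 ∎
    where
    open ℕₚ.≤-Reasoning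
    signs : ∀ (v : Vec (Fin k) n) → Tri (weight v ℤ.< 0ℤ) (weight v ≡ 0ℤ) (0ℤ ℤ.< weight v) →
      weight v ℤ.< 0ℤ ⊎ weight v ≡ 0ℤ ⊎ 0ℤ ℤ.< weight v
    signs v (tri< <0 _ _) = inj₁ <0
    signs v (tri≈ _ ≡0 _) = inj₂ (inj₁ ≡0)
    signs v (tri> _ _ >0) = inj₂ (inj₂ >0)
    P = length (positives n)
    T = length (ties n)

  -- Lower bound: one cycle through all strings of positive weight

  module Construct (t : Fin k) (g≤gt : ∀ a → g a ℤ.≤ g t) (0<gt : 0ℤ ℤ.< g t) (m : ℕ) where

    String : Set
    String = Vec (Fin k) (suc m)

    -- An edge of the de Bruijn graph that does not leave the positive strings. Stating positivity
    -- as an implication lets the walk be a permutation of all strings, while a cycle that meets a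
    -- positive string stays among them.
    Successor : String → String → Set
    Successor x y = (∃[ c ] y ≡ tail x ∷ʳ c) × (0ℤ ℤ.< weight x → 0ℤ ℤ.< weight y)

    open FinitePermutation {String} (Vecₚ.≡-dec Fₚ._≟_) code code-injective
    open Joining Successor

    rotate : String → String
    rotate x = tail x ∷ʳ head x

    rotate-injective : ∀ {x y} → rotate x ≡ rotate y → x ≡ y
    rotate-injective {a ∷ v} {b ∷ w} eq with v≡w , a≡b ← Vecₚ.∷ʳ-injective v w eq = cong₂ _∷_ a≡b v≡w

    rotation : Walk
    rotation = record
      { next           = rotate
      ; next-injective = rotate-injective
      ; next-allowed   = λ { (a ∷ v) → (a , refl) , subst (0ℤ ℤ.<_) (sym (weight-∷ʳ v a)) }
      }

    parent : String → String
    parent x = t ∷ tail x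

    weight-parent : ∀ x → weight x ℤ.≤ weight (parent x)
    weight-parent (a ∷ v) = ℤₚ.+-monoˡ-≤ (weight v) (g≤gt a)

    -- The two strings have the same tail, hence the same shifts; as both are positive, the second
    -- clause of `Successor` asks the same of y for either.
    parent-twin : ∀ {x} → 0ℤ ℤ.< weight x → Twin x (parent x)
    parent-twin {x} 0<x =
      (λ { (shift , pos) → shift , λ _ → pos 0<x }) ,
      (λ { (shift , pos) → shift , λ _ → pos (ℤₚ.<-≤-trans 0<x (weight-parent x)) })

    root : String
    root = replicate (suc m) t

    weight-replicate : ∀ n → 0ℤ ℤ.≤ weight (replicate n t)
    weight-replicate zero    = ℤₚ.≤-refl
    weight-replicate (suc n) = ℤₚ.+-mono-≤ (ℤₚ.<⇒≤ 0<gt) (weight-replicate n)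

    0<weight-root : 0ℤ ℤ.< weight root
    0<weight-root = ℤₚ.+-mono-<-≤ 0<gt (weight-replicate m)

    abstract
      joined : ∃[ w ] (rotation ⊑ w × All (λ x → Leads (next w) x (parent x)) (positives (suc m)))
      joined = joinAll rotation parent (All.map (λ {x} → parent-twin {x})
        (Allₚ.all-filter (λ v → 0ℤ ℤₚ.<? weight v) (strings k (suc m))))

    walk : Walk
    walk = proj₁ joined

    σ : String → String
    σ = next walk

    leads-parent : ∀ {x} → 0ℤ ℤ.< weight x → Leads σ x (parent x)
    leads-parent {x} 0<x = All.lookup (proj₂ (proj₂ joined)) (∈-filter⁺ _ (∈-strings x) 0<x)

    -- The joins only coarsen the cycles of `rotation`, so the rotated string stays reachable even
    -- where `σ` no longer rotates.
    leads-rotate : ∀ x → Leads σ x (rotate x)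
    leads-rotate x = proj₁ (proj₂ joined) (leads-step {σ = rotate})

    open Orbit σ (next-injective walk)

    all-t⇒root : ∀ {n} (x : Vec (Fin k) n) → All (_≡ t) (toList x) → x ≡ replicate n t
    all-t⇒root []      []          = refl
    all-t⇒root (a ∷ v) (refl ∷ ts) = cong (t ∷_) (all-t⇒root v ts)

    -- Replacing the first letter by t and rotating, |u| times, turns u ++ w into w followed by t's.
    leads-root : ∀ u {w} x → toList x ≡ u List.++ w → All (_≡ t) w → 0ℤ ℤ.< weight x → Leads σ x root
    leads-root []      x       refl ts 0<x = 0 , all-t⇒root x ts
    leads-root (b ∷ u) {w} x@(a ∷ v) eq ts 0<x =
      leads-trans (leads-parent 0<x) (leads-trans (leads-rotate (t ∷ v))
        (leads-root u (v ∷ʳ t) split (Allₚ.++⁺ ts (refl ∷ []))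
          (subst (0ℤ ℤ.<_) (sym (weight-∷ʳ v t)) (ℤₚ.<-≤-trans 0<x (weight-parent x)))))
      where
      split : toList (v ∷ʳ t) ≡ u List.++ (w List.++ (t ∷ []))
      split = begin
        toList (v ∷ʳ t)                  ≡⟨ Vecₚ.toList-∷ʳ t v ⟩
        toList v List.++ (t ∷ [])        ≡⟨ cong (λ l → l List.++ (t ∷ [])) (Listₚ.∷-injectiveʳ eq) ⟩
        (u List.++ w) List.++ (t ∷ [])   ≡⟨ Listₚ.++-assoc u w (t ∷ []) ⟩
        u List.++ (w List.++ (t ∷ []))   ∎
        where open ≡-Reasoning

    root-leads : ∀ {x} → 0ℤ ℤ.< weight x → Leads σ root x
    root-leads {x} 0<x = leads-sym (leads-root (toList x) x (sym (Listₚ.++-identityʳ _)) [] 0<x)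

    state : ℕ → String
    state = iterate σ root

    0<weight-state : ∀ i → 0ℤ ℤ.< weight (state i)
    0<weight-state i = go i 0<weight-root
      where
      go : ∀ i {x} → 0ℤ ℤ.< weight x → 0ℤ ℤ.< weight (iterate σ x i)
      go zero    0<x = 0<x
      go (suc i) 0<x = go i (proj₂ (next-allowed walk _) 0<x)

    s : ℕ → ℕ
    s i = toℕ (head (state i))

    lookup-tail-∷ʳ : ∀ (x : String) c {j} {i : Fin (suc m)} {i⁺ : Fin (suc m)} →
      toℕ i ≡ j → toℕ i⁺ ≡ suc j → lookup (tail x ∷ʳ c) i ≡ lookup x i⁺
    lookup-tail-∷ʳ (a ∷ v) c {i⁺ = F.suc i′} refl eq = go v i′ (sym (ℕₚ.suc-injective eq))
      where
      go : ∀ {n} (v : Vec (Fin k) n) i′ {i} → toℕ i ≡ toℕ i′ → lookup (v ∷ʳ c) i ≡ lookup v i′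
      go (b ∷ v) F.zero     {F.zero}  _  = refl
      go (b ∷ v) (F.suc i′) {F.suc i} eq = go v i′ (ℕₚ.suc-injective eq)

    -- Every step shifts the string left by one, so the letter at position j is the head j steps
    -- later. Hence the window of `s` at i spells out `state i`.
    lookup-iterate : ∀ j {i : Fin (suc m)} x → toℕ i ≡ j → lookup x i ≡ head (iterate σ x j)
    lookup-iterate zero    {F.zero}    (a ∷ v) _  = refl
    lookup-iterate (suc j) {F.suc i′}  x       eq with c , σx≡ ← proj₁ (next-allowed walk x) =
      trans (sym (trans (cong (λ y → lookup y (F.inject₁ i′)) σx≡) (lookup-tail-∷ʳ x c i≡j eq)))
            (lookup-iterate j (σ x) i≡j)
      where
      i≡j : toℕ (F.inject₁ i′) ≡ j
      i≡j = trans (Fₚ.toℕ-inject₁ i′) (ℕₚ.suc-injective eq)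

    window≡state : ∀ i → window s (suc m) i ≡ Vec.map toℕ (state i)
    window≡state i = trans
      (Vecₚ.tabulate-cong (λ j → cong toℕ (trans (cong head (iterate-+ σ i (toℕ j) root))
        (sym (lookup-iterate (toℕ j) (state i) refl)))))
      (trans (Vecₚ.tabulate-∘ toℕ (lookup (state i))) (cong (Vec.map toℕ) (Vecₚ.tabulate∘lookup (state i))))

    window≡⇒state≡ : ∀ i j → window s (suc m) i ≡ window s (suc m) j → state i ≡ state j
    window≡⇒state≡ i j eq = map-toℕ-injective (trans (sym (window≡state i)) (trans eq (window≡state j)))

    nos : ∃[ s ] ∃[ p ] (IsNOS (suc m) k s p × length (positives (suc m)) ≤ p)
    nos with p , eq , min ← order root = s , suc p ,
      ((λ i → Fₚ.toℕ<n (head (state i))) , (s≤s z≤n , periodic , minimal) ,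
        (λ i j e → iterate-≡⇒%-≡ eq min i j (window≡⇒state≡ i j e)) , oriented) , covers
      where
      periodic : ∀ i → s (i + suc p) ≡ s i
      periodic i = cong (λ x → toℕ (head x)) (trans (cong state (ℕₚ.+-comm i (suc p)))
        (trans (iterate-+ σ (suc p) i root) (cong (λ x → iterate σ x i) eq)))

      minimal : ∀ q → 0 ℕ.< q → (∀ i → s (i + q) ≡ s i) → suc p ≤ q
      -- A shift that fixes `s` fixes its window at 0, so it brings the walk back to the root, and
      -- the minimality of `p` applies.
      minimal (suc q) _ per = s≤s (min (window≡⇒state≡ (suc q) 0 (Vecₚ.tabulate-cong
        λ j → trans (cong s (ℕₚ.+-comm (suc q) (toℕ j))) (per (toℕ j)))))

      oriented : ∀ i j → window s (suc m) i ≢ Vec.map (negMod k) (reverse (window s (suc m) j))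
      oriented i j e = ℤₚ.<-asym (0<weight-state i) (subst (ℤ._< 0ℤ) (sym weight≡) (ℤₚ.neg-mono-< (0<weight-state j)))
        where
        weight≡ : weight (state i) ≡ ℤ.- weight (state j)
        weight≡ = begin
          weight (state i)                          ≡⟨ cong weight (map-toℕ-injective (trans (sym (window≡state i)) (trans e
                                                        (trans (cong (λ v → Vec.map (negMod k) (reverse v)) (window≡state j)) (map-negMod (state j)))))) ⟩
          weight (Vec.map neg (reverse (state j)))  ≡⟨ weight-neg (reverse (state j)) ⟩
          ℤ.- weight (reverse (state j))            ≡⟨ cong ℤ.-_ (weight-reverse (state j)) ⟩
          ℤ.- weight (state j)                      ∎
          where open ≡-Reasoning

      covers : length (positives (suc m)) ≤ suc p
      covers = subst (length (positives (suc m)) ≤_) (Listₚ.length-applyUpTo state (suc p))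
        (injection⇒length≤ (λ x → x) (Uniqueₚ.filter⁺ _ (strings-unique k (suc m))) (λ _ _ e → e)
          λ {x} x∈ → visited (root-leads (proj₂ (∈-filter⁻ (λ v → 0ℤ ℤₚ.<? weight v) {xs = strings k (suc m)} x∈))))
        where
        visited : ∀ {x} → Leads σ root x → x ∈ List.applyUpTo state (suc p)
        visited (i , refl) = subst (_∈ List.applyUpTo state (suc p)) (iterate-% σ i eq)
          (∈-applyUpTo⁺ state (m%n<n i (suc p)))

  maxPeriod-bounds : (t : Fin k) → (∀ a → g a ℤ.≤ g t) → 0ℤ ℤ.< g t → ∀ {n L} → 1 ≤ n → IsMaxPeriod n k L →
    2 * L ≤ k ^ n × k ^ n ≤ 2 * L + length (ties n)
  maxPeriod-bounds t g≤gt 0<gt {suc m} {L} _ ((_ , isNOS) , max) =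
    NOS-period-bound isNOS ,
    ℕₚ.≤-trans (k^n≤2positives+ties (suc m)) (ℕₚ.+-monoˡ-≤ _ (ℕₚ.*-monoʳ-≤ 2 (positives≤L (Construct.nos t g≤gt 0<gt m))))
    where
    positives≤L : ∃[ s ] ∃[ p ] (IsNOS (suc m) k s p × length (positives (suc m)) ≤ p) → length (positives (suc m)) ≤ L
    positives≤L (s , p , isNOSₚ , covers) = ℕₚ.≤-trans covers (max s p isNOSₚ)

-- Counting the strings of weight zero

-- trinomial m n j is the coefficient of x^j (equivalently of x^-j) in (1 + m + x + 1/x)^n.
trinomial : ℕ → ℕ → ℕ → ℕ
trinomial m zero    zero    = 1
trinomial m zero    (suc j) = 0
trinomial m (suc n) zero    = suc m * trinomial m n 0 + 2 * trinomial m n 1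
trinomial m (suc n) (suc j) = suc m * trinomial m n (suc j) + (trinomial m n j + trinomial m n (2 + j))

module Trinomial (m : ℕ) where

  open ℕₚ

  private
    v : ℕ → ℕ → ℕ
    v = trinomial m
    k : ℕ
    k = 3 + m

  -- The summand 1 in `suc m` matters: in (x + 1/x)^n every other coefficient vanishes. At j = 0 one
  -- of the `suc m` copies of `v n 1` is set aside, so that `v n 2` can be compared with `v n 1` and
  -- the other copies with `v n 0`.
  antitone : ∀ n j → v n (suc j) ≤ v n j
  antitone zero    j       = z≤n
  antitone (suc n) zero    = begin
    suc m * v n 1 + (v n 0 + v n 2)      ≡⟨ lhs m (v n 0) (v n 1) (v n 2) ⟩
    m * v n 1 + (v n 0 + (v n 1 + v n 2)) ≤⟨ +-mono-≤ (*-monoʳ-≤ m (antitone n 0))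
                                                (+-monoʳ-≤ (v n 0) (+-monoʳ-≤ (v n 1) (antitone n 1))) ⟩
    m * v n 0 + (v n 0 + (v n 1 + v n 1)) ≡⟨ rhs m (v n 0) (v n 1) ⟩
    suc m * v n 0 + 2 * v n 1            ∎
    where
    open ≤-Reasoning
    lhs : ∀ m a b c → suc m * b + (a + c) ≡ m * b + (a + (b + c))
    lhs = solve-∀
    rhs : ∀ m a b → m * a + (a + (b + b)) ≡ suc m * a + 2 * b
    rhs = solve-∀
  antitone (suc n) (suc j) =
    +-mono-≤ (*-monoʳ-≤ (suc m) (antitone n (suc j))) (+-mono-≤ (antitone n j) (antitone n (2 + j)))

  ≤central : ∀ n j → v n j ≤ v n 0
  ≤central n zero    = ≤-refl
  ≤central n (suc j) = ≤-trans (antitone n j) (≤central n j)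

  -- The sum of the coefficients of x^-j, …, x^j.
  total : ℕ → ℕ → ℕ
  total n zero    = v n 0
  total n (suc j) = total n j + 2 * v n (suc j)

  -- The factors x and 1/x shift the interval of exponents by one to either side; together the two
  -- shifted intervals cover the interval one wider and the interval one narrower at both ends.
  total-suc : ∀ n j → total (suc n) (suc j) ≡ suc m * total n (suc j) + (total n (2 + j) + total n j)
  total-suc n zero    = identity m (v n 0) (v n 1) (v n 2)
    where
    identity : ∀ m a b c → (suc m * a + 2 * b) + 2 * (suc m * b + (a + c)) ≡
                           suc m * (a + 2 * b) + (((a + 2 * b) + 2 * c) + a)
    identity = solve-∀
  total-suc n (suc j) = trans (cong (_+ 2 * v (suc n) (2 + j)) (total-suc n j))
    (identity m (total n j) (total n (suc j)) (total n (2 + j)) (v n (suc j)) (v n (2 + j)) (v n (3 + j)) refl)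
    where
    identity : ∀ m t₀ t₁ t₂ b c d → t₁ ≡ t₀ + 2 * b →
      (suc m * t₁ + (t₂ + t₀)) + 2 * (suc m * c + (b + d)) ≡ suc m * (t₁ + 2 * c) + ((t₂ + 2 * d) + t₁)
    identity m t₀ _ t₂ b c d refl = ring m t₀ t₂ b c d
      where
      ring : ∀ m t₀ t₂ b c d → (suc m * (t₀ + 2 * b) + (t₂ + t₀)) + 2 * (suc m * c + (b + d)) ≡
        suc m * ((t₀ + 2 * b) + 2 * c) + ((t₂ + 2 * d) + (t₀ + 2 * b))
      ring = solve-∀

  -- All coefficients are nonnegative and add up to k^n, as x = 1 shows. The induction treats all j
  -- together, because `total-suc` refers to both neighbours of an interval; for j = 0 the narrower
  -- one is empty.
  total≤k^n : ∀ n j → total n j ≤ k ^ n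
  total≤k^n zero    zero    = ≤-refl
  total≤k^n zero    (suc j) = ≤-trans (≤-reflexive (+-identityʳ _)) (total≤k^n zero j)
  total≤k^n (suc n) zero    = begin
    suc m * v n 0 + 2 * v n 1    ≤⟨ +-monoʳ-≤ (suc m * v n 0) (m≤n+m _ (v n 0)) ⟩
    suc m * v n 0 + total n 1    ≤⟨ +-mono-≤ (*-monoʳ-≤ (suc m) (total≤k^n n 0)) (total≤k^n n 1) ⟩
    suc m * k ^ n + k ^ n        ≡⟨ +-comm (suc m * k ^ n) (k ^ n) ⟩
    (2 + m) * k ^ n              ≤⟨ m≤n+m _ (k ^ n) ⟩
    k * k ^ n                    ∎
    where open ≤-Reasoning
  total≤k^n (suc n) (suc j) = begin
    total (suc n) (suc j)                                   ≡⟨ total-suc n j ⟩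
    suc m * total n (suc j) + (total n (2 + j) + total n j) ≤⟨ +-mono-≤ (*-monoʳ-≤ (suc m) (total≤k^n n (suc j)))
                                                                (+-mono-≤ (total≤k^n n (2 + j)) (total≤k^n n j)) ⟩
    suc m * k ^ n + (k ^ n + k ^ n)                         ≡⟨ identity m (k ^ n) ⟩
    k * k ^ n                                               ∎
    where
    open ≤-Reasoning
    identity : ∀ m a → suc m * a + (a + a) ≡ (3 + m) * a
    identity = solve-∀

  -- By `antitone` the outermost coefficient is the smallest of the 2j + 1 that are added, and j + 1
  -- of them are enough for the bound.
  suc-j*v≤total : ∀ n j → suc j * v n j ≤ total n j
  suc-j*v≤total n zero    = ≤-reflexive (+-identityʳ _)
  suc-j*v≤total n (suc j) = begin
    v n (suc j) + suc j * v n (suc j) ≤⟨ +-mono-≤ (m≤m+n (v n (suc j)) (v n (suc j) + 0))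
                                          (≤-trans (*-monoʳ-≤ (suc j) (antitone n j)) (suc-j*v≤total n j)) ⟩
    2 * v n (suc j) + total n j       ≡⟨ +-comm (2 * v n (suc j)) (total n j) ⟩
    total n (suc j)                   ∎
    where open ≤-Reasoning

  suc-j*v≤k^n : ∀ n j → suc j * v n j ≤ k ^ n
  suc-j*v≤k^n n j = ≤-trans (suc-j*v≤total n j) (total≤k^n n j)

  central-suc : ∀ n → v (suc n) 0 ≤ k * v n 0
  central-suc n = begin
    suc m * v n 0 + 2 * v n 1 ≤⟨ +-monoʳ-≤ (suc m * v n 0) (*-monoʳ-≤ 2 (antitone n 0)) ⟩
    suc m * v n 0 + 2 * v n 0 ≡⟨ identity m (v n 0) ⟩
    k * v n 0                 ∎
    where
    open ≤-Reasoning
    identity : ∀ m a → suc m * a + 2 * a ≡ (3 + m) * a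
    identity = solve-∀

  -- One of the k letters moves outwards to `suc j`; the other 2 + m contribute at most the central
  -- coefficient each.
  v-suc : ∀ n j → v (suc n) j ≤ (2 + m) * v n 0 + v n (suc j)
  v-suc n zero = begin
    suc m * v n 0 + 2 * v n 1         ≡⟨ lhs m (v n 0) (v n 1) ⟩
    (suc m * v n 0 + v n 1) + v n 1   ≤⟨ +-monoˡ-≤ (v n 1) (+-monoʳ-≤ (suc m * v n 0) (antitone n 0)) ⟩
    (suc m * v n 0 + v n 0) + v n 1   ≡⟨ cong (_+ v n 1) (+-comm (suc m * v n 0) (v n 0)) ⟩
    (2 + m) * v n 0 + v n 1           ∎
    where
    open ≤-Reasoning
    lhs : ∀ m a b → suc m * a + 2 * b ≡ (suc m * a + b) + b
    lhs = solve-∀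
  v-suc n (suc j) = begin
    suc m * v n (suc j) + (v n j + v n (2 + j)) ≤⟨ +-mono-≤ (*-monoʳ-≤ (suc m) (≤central n (suc j))) (+-monoˡ-≤ (v n (2 + j)) (≤central n j)) ⟩
    suc m * v n 0 + (v n 0 + v n (2 + j))       ≡⟨ identity m (v n 0) (v n (2 + j)) ⟩
    (2 + m) * v n 0 + v n (2 + j)               ∎
    where
    open ≤-Reasoning
    identity : ∀ m a b → suc m * a + (a + b) ≡ (2 + m) * a + b
    identity = solve-∀

  -- This is k^j - 1, by a recursion free of subtraction: the number of words of length j other than
  -- the one that always moves outwards.
  pred-k^ : ℕ → ℕ
  pred-k^ zero    = 0
  pred-k^ (suc j) = k * pred-k^ j + (2 + m)

  suc-pred-k^ : ∀ j → suc (pred-k^ j) ≡ k ^ j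
  suc-pred-k^ zero    = refl
  suc-pred-k^ (suc j) = trans (identity m (pred-k^ j)) (cong (k *_) (suc-pred-k^ j))
    where
    identity : ∀ m a → suc ((3 + m) * a + (2 + m)) ≡ (3 + m) * suc a
    identity = solve-∀

  -- Among the k^j words of length j, the one with all letters of weight 1 contributes `v n j`, and
  -- each of the others at most `v n 0`.
  central-+ : ∀ j n → v (j + n) 0 ≤ v n j + pred-k^ j * v n 0
  central-+ zero    n = m≤m+n _ _
  central-+ (suc j) n = begin
    v (suc j + n) 0                                         ≡⟨ cong (λ i → v i 0) (+-suc j n) ⟨
    v (j + suc n) 0                                         ≤⟨ central-+ j (suc n) ⟩
    v (suc n) j + pred-k^ j * v (suc n) 0                   ≤⟨ +-mono-≤ (v-suc n j) (*-monoʳ-≤ (pred-k^ j) (central-suc n)) ⟩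
    ((2 + m) * v n 0 + v n (suc j)) + pred-k^ j * (k * v n 0) ≡⟨ identity m (v n 0) (v n (suc j)) (pred-k^ j) ⟩
    v n (suc j) + pred-k^ (suc j) * v n 0                   ∎
    where
    open ≤-Reasoning
    identity : ∀ m a b c → ((2 + m) * a + b) + c * ((3 + m) * a) ≡ b + ((3 + m) * c + (2 + m)) * a
    identity = solve-∀

  module Decay (j : ℕ) where

    Low : ℕ → Set
    Low n = suc j * v n 0 ≤ 2 * k ^ n

    low-suc : ∀ n → Low n → Low (suc n)
    low-suc n low = begin
      suc j * v (suc n) 0   ≤⟨ *-monoʳ-≤ (suc j) (central-suc n) ⟩
      suc j * (k * v n 0)   ≡⟨ swap (suc j) k (v n 0) ⟩
      k * (suc j * v n 0)   ≤⟨ *-monoʳ-≤ k low ⟩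
      k * (2 * k ^ n)       ≡⟨ swap k 2 (k ^ n) ⟩
      2 * (k * k ^ n)       ∎
      where
      open ≤-Reasoning
      swap : ∀ a b c → a * (b * c) ≡ b * (a * c)
      swap = solve-∀

    low-+ : ∀ d n → Low n → Low (d + n)
    low-+ zero    n low = low
    low-+ (suc d) n low = low-suc (d + n) (low-+ d n low)

    M : ℕ
    M = suc j * k ^ j

    -- Each block of j further letters either finds the central proportion v n 0 / k^n below
    -- 2 / (j + 1) or lowers it by at least 1 / M, so the latter happens at most M times.
    Dropped : ℕ → ℕ → Set
    Dropped i n = M * v n 0 + i * k ^ n ≤ M * k ^ n

    block : ∀ i n → Dropped i n → Low n ⊎ Dropped (suc i) (j + n)
    block i n dropped with ≤-total (suc j * v n 0) (2 * k ^ n)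
    ... | inj₁ low  = inj₁ low
    ... | inj₂ high = inj₂ (begin
      M * v (j + n) 0 + suc i * k ^ (j + n)
        ≡⟨ cong (λ x → M * v (j + n) 0 + suc i * x) (^-distribˡ-+-* k j n) ⟩
      M * v (j + n) 0 + suc i * (k ^ j * k ^ n)
        ≡⟨ collect (suc j) (k ^ j) (v (j + n) 0) i (k ^ n) ⟩
      k ^ j * ((suc j * v (j + n) 0 + k ^ n) + i * k ^ n)
        ≤⟨ *-monoʳ-≤ (k ^ j) (+-monoˡ-≤ (i * k ^ n) shrink) ⟩
      k ^ j * (M * v n 0 + i * k ^ n)
        ≤⟨ *-monoʳ-≤ (k ^ j) dropped ⟩
      k ^ j * (M * k ^ n)
        ≡⟨ swap (k ^ j) M (k ^ n) ⟩
      M * (k ^ j * k ^ n)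
        ≡⟨ cong (M *_) (^-distribˡ-+-* k j n) ⟨
      M * k ^ (j + n) ∎)
      where
      open ≤-Reasoning
      swap : ∀ a b c → a * (b * c) ≡ b * (a * c)
      swap = solve-∀
      collect : ∀ s p a i q → s * p * a + suc i * (p * q) ≡ p * ((s * a + q) + i * q)
      collect = solve-∀
      expand : ∀ s b c a q → s * (b + c * a) + q ≡ (s * b + q) + s * c * a
      expand = solve-∀
      contract : ∀ s c a → s * a + s * c * a ≡ s * suc c * a
      contract = solve-∀
      -- In the high case the share (j + 1) `v n 0` of the outward word is at least 2 k^n, whereas
      -- that word costs only (j + 1) `v n j` ≤ k^n. The surplus k^n is the drop.
      shrink : suc j * v (j + n) 0 + k ^ n ≤ M * v n 0
      shrink = begin
        suc j * v (j + n) 0 + k ^ n                       ≤⟨ +-monoˡ-≤ (k ^ n) (*-monoʳ-≤ (suc j) (central-+ j n)) ⟩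
        suc j * (v n j + pred-k^ j * v n 0) + k ^ n       ≡⟨ expand (suc j) (v n j) (pred-k^ j) (v n 0) (k ^ n) ⟩
        (suc j * v n j + k ^ n) + suc j * pred-k^ j * v n 0 ≤⟨ +-monoˡ-≤ _ (+-monoˡ-≤ (k ^ n) (suc-j*v≤k^n n j)) ⟩
        (k ^ n + k ^ n) + suc j * pred-k^ j * v n 0       ≡⟨ cong (λ x → k ^ n + x + suc j * pred-k^ j * v n 0) (+-identityʳ (k ^ n)) ⟨
        2 * k ^ n + suc j * pred-k^ j * v n 0             ≤⟨ +-monoˡ-≤ _ high ⟩
        suc j * v n 0 + suc j * pred-k^ j * v n 0         ≡⟨ contract (suc j) (pred-k^ j) (v n 0) ⟩
        suc j * suc (pred-k^ j) * v n 0                   ≡⟨ cong (λ x → suc j * x * v n 0) (suc-pred-k^ j) ⟩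
        M * v n 0                                         ∎

    blocks : ∀ i → Low (i * j) ⊎ Dropped i (i * j)
    blocks zero    = inj₂ (≤-reflexive (+-identityʳ _))
    blocks (suc i) with blocks i
    ... | inj₁ low     = inj₁ (low-+ j (i * j) low)
    ... | inj₂ dropped with block i (i * j) dropped
    ...   | inj₁ low      = inj₁ (low-+ j (i * j) low)
    ...   | inj₂ dropped′ = inj₂ dropped′

    low-eventually : ∀ {n} → M * j ≤ n → Low n
    low-eventually {n} le = subst Low (m∸n+n≡m le) (low-+ (n ∸ M * j) (M * j) low)
      where
      low : Low (M * j)
      low with blocks M
      ... | inj₁ l = l
      -- After M drops nothing is left: `d` forces the central coefficient to be 0.
      ... | inj₂ d = ≤-trans (begin
        suc j * v (M * j) 0         ≤⟨ *-monoˡ-≤ (v (M * j) 0) (m≤m*n (suc j) (k ^ j) {{m^n≢0 k j}}) ⟩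
        M * v (M * j) 0             ≤⟨ +-cancelʳ-≤ (M * k ^ (M * j)) (M * v (M * j) 0) 0 d ⟩
        0                           ∎) z≤n
        where open ≤-Reasoning

-- The two odd weights and their ties

-- Antisymmetrising an arbitrary `h` under a ↔ -a yields a weight that is odd by construction.
odd : ∀ {r} → (Fin r → ℕ) → Fin (suc r) → ℤ
odd h F.zero    = 0ℤ
odd h (F.suc i) = h i ⊖ h (opposite i)

odd-neg : ∀ {r} (h : Fin r → ℕ) a → odd h (neg a) ≡ ℤ.- odd h a
odd-neg h F.zero    = refl
odd-neg h (F.suc i) = trans (cong (λ j → h (opposite i) ⊖ h j) (Fₚ.opposite-involutive i))
  (ℤₚ.⊖-swap (h (opposite i)) (h i))

opposite-fromℕ : ∀ r → opposite (fromℕ r) ≡ F.zero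
opposite-fromℕ r = Fₚ.opposite-involutive F.zero

module _ {r} (h : Fin (suc r) → ℕ) (h≤ : ∀ i → h i ≤ h (fromℕ r)) (h≥ : ∀ i → h F.zero ≤ h i)
         (h< : h F.zero ℕ.< h (fromℕ r)) where

  private
    odd-last : odd h (F.suc (fromℕ r)) ≡ h (fromℕ r) ⊖ h F.zero
    odd-last = cong (λ i → h (fromℕ r) ⊖ h i) (opposite-fromℕ r)

  0<odd-last : 0ℤ ℤ.< odd h (F.suc (fromℕ r))
  0<odd-last = subst₂ ℤ._<_ (ℤₚ.n⊖n≡0 (h F.zero)) (sym odd-last) (ℤₚ.⊖-monoˡ-< (h F.zero) h<)

  -- The letter k - 1, that is -1, pairs the largest value of `h` with the smallest, so it can serve
  -- as the letter `t` of maximal weight.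
  odd≤odd-last : ∀ a → odd h a ℤ.≤ odd h (F.suc (fromℕ r))
  odd≤odd-last F.zero    = ℤₚ.<⇒≤ 0<odd-last
  odd≤odd-last (F.suc i) = subst (odd h (F.suc i) ℤ.≤_) (sym odd-last)
    (ℤₚ.≤-trans (ℤₚ.⊖-monoˡ-≤ (h (opposite i)) (h≤ i)) (ℤₚ.⊖-monoʳ-≥-≤ (h (fromℕ r)) (h≥ (opposite i))))

  odd-maxPeriod-bounds : ∀ {n L} → 1 ≤ n → IsMaxPeriod n (2 + r) L →
    2 * L ≤ (2 + r) ^ n × (2 + r) ^ n ≤ 2 * L + length (Weighted.ties (odd h) (odd-neg h) n)
  odd-maxPeriod-bounds = Weighted.maxPeriod-bounds (odd h) (odd-neg h) (F.suc (fromℕ r)) odd≤odd-last 0<odd-last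

module LinearWeight (r : ℕ) where

  h : Fin (suc r) → ℕ
  h = toℕ

  open Weighted (odd h) (odd-neg h)

  opposite-anti : ∀ {i j : Fin (suc r)} → toℕ i ℕ.< toℕ j → toℕ (opposite j) ≤ toℕ (opposite i)
  opposite-anti {i} {j} i<j = subst₂ _≤_ (sym (Fₚ.opposite-prop j)) (sym (Fₚ.opposite-prop i))
    (ℕₚ.∸-monoʳ-≤ (suc r) (s≤s (ℕₚ.<⇒≤ i<j)))

  odd-mono : ∀ {i j : Fin (suc r)} → toℕ i ℕ.< toℕ j → odd h (F.suc i) ℤ.< odd h (F.suc j)
  odd-mono {i} {j} i<j = ℤₚ.<-≤-trans (ℤₚ.⊖-monoˡ-< (toℕ (opposite i)) i<j)
    (ℤₚ.⊖-monoʳ-≥-≤ (toℕ j) (opposite-anti i<j))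

  odd-injective : ∀ {i j : Fin (suc r)} → odd h (F.suc i) ≡ odd h (F.suc j) → i ≡ j
  odd-injective {i} {j} eq with ℕₚ.<-cmp (toℕ i) (toℕ j)
  ... | tri< i<j _ _ = ⊥-elim (ℤₚ.<-irrefl eq (odd-mono i<j))
  ... | tri≈ _ i≡j _ = Fₚ.toℕ-injective i≡j
  ... | tri> _ _ j<i = ⊥-elim (ℤₚ.<-irrefl (sym eq) (odd-mono j<i))

  -- For even k the letters 0 and k/2 both have weight 0, so the weight determines a letter only
  -- together with this bit.
  isZero : Fin (2 + r) → Fin 2
  isZero F.zero    = F.zero
  isZero (F.suc _) = F.suc F.zero

  sameClass⇒≡ : ∀ a b → isZero a ≡ isZero b → odd h a ≡ odd h b → a ≡ b
  sameClass⇒≡ F.zero    F.zero    _ _  = refl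
  sameClass⇒≡ (F.suc i) (F.suc j) _ eq = cong F.suc (odd-injective eq)

  -- In a tie the weight of the first letter is forced by the others, which leaves at most two letters.
  ties≤ : ∀ n → length (ties (suc n)) ≤ 2 * (2 + r) ^ n
  ties≤ n = subst (length (ties (suc n)) ≤_) (Listₚ.length-tabulate {n = 2 * (2 + r) ^ n} (λ i → i))
    (injection⇒length≤ {ys = allFin (2 * (2 + r) ^ n)} squash (Uniqueₚ.filter⁺ _ (strings-unique (2 + r) (suc n)))
      (λ {x} {y} x∈ y∈ → squash-injective x y (tie x∈) (tie y∈)) (λ _ → ∈-allFin _))
    where
    squash : Vec (Fin (2 + r)) (suc n) → Fin (2 * (2 + r) ^ n)
    squash (a ∷ v) = combine (isZero a) (code v)

    tie : ∀ {x} → x ∈ ties (suc n) → weight x ≡ 0ℤ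
    tie x∈ = proj₂ (∈-filter⁻ (λ v → weight v ℤₚ.≟ 0ℤ) {xs = strings (2 + r) (suc n)} x∈)

    squash-injective : ∀ x y → weight x ≡ 0ℤ → weight y ≡ 0ℤ → squash x ≡ squash y → x ≡ y
    squash-injective (a ∷ v) (b ∷ w) x₀ y₀ eq
      with a~b , cv≡cw ← Fₚ.combine-injective (isZero a) (code v) (isZero b) (code w) eq
      with refl ← code-injective {v = v} {w} cv≡cw =
      cong (_∷ v) (sameClass⇒≡ a b a~b (∙-cancelʳ (weight v) _ _ (trans x₀ (sym y₀))))

  bounds : 1 ≤ r → ∀ {n L} → IsMaxPeriod (suc n) (2 + r) L →
    2 * L ≤ (2 + r) ^ suc n × (2 + r) ^ suc n ≤ 2 * L + 2 * (2 + r) ^ n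
  bounds 1≤r {n} {L} isMax = proj₁ b , ℕₚ.≤-trans (proj₂ b) (ℕₚ.+-monoʳ-≤ (2 * L) (ties≤ n))
    where
    b = odd-maxPeriod-bounds h (λ i → subst (toℕ i ≤_) (sym (Fₚ.toℕ-fromℕ r)) (ℕ.s≤s⁻¹ (Fₚ.toℕ<n i)))
          (λ _ → z≤n) (subst (0 ℕ.<_) (sym (Fₚ.toℕ-fromℕ r)) 1≤r) (s≤s z≤n) isMax

length-filter-map : {A B : Set} {P : B → Set} (P? : Decidable P) (f : A → B) (xs : List A) →
  length (filter P? (List.map f xs)) ≡ length (filter (λ x → P? (f x)) xs)
length-filter-map P? f []       = refl
length-filter-map P? f (x ∷ xs) with P? (f x)
... | yes _ = cong suc (length-filter-map P? f xs)
... | no _  = length-filter-map P? f xs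

length-filter-cartesianProductWith : {A B C : Set} {P : C → Set} (P? : Decidable P) (f : A → B → C)
  (xs : List A) (ys : List B) →
  length (filter P? (cartesianProductWith f xs ys)) ≡ sum (List.map (λ x → length (filter (λ y → P? (f x y)) ys)) xs)
length-filter-cartesianProductWith P? f []       ys = refl
length-filter-cartesianProductWith P? f (x ∷ xs) ys = trans
  (cong length (Listₚ.filter-++ P? (List.map f′ ys) (cartesianProductWith f xs ys)))
  (trans (Listₚ.length-++ (filter P? (List.map f′ ys)))
    (cong₂ _+_ (length-filter-map P? f′ ys) (length-filter-cartesianProductWith P? f xs ys)))
  where f′ = f x

module SignWeight (m : ℕ) where

  isFirst : ∀ {n} → Fin n → ℕ
  isFirst F.zero    = 1
  isFirst (F.suc _) = 0

  -- odd h is 1 at the letter −1, −1 at the letter 1 and 0 elsewhere.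
  h : Fin (2 + m) → ℕ
  h i = isFirst (opposite i)

  open Weighted (odd h) (odd-neg h)

  private
    k : ℕ
    k = 3 + m

  isFirst-inject₁ : ∀ {n} (i : Fin n) → isFirst (F.inject₁ i) ≡ isFirst i
  isFirst-inject₁ F.zero    = refl
  isFirst-inject₁ (F.suc i) = refl

  sum-isFirst : ∀ (f : ℤ → ℕ) n →
    sum (List.tabulate {n = suc n} (λ i → f (isFirst (opposite i) ⊖ 0))) ≡ n * f 0ℤ + f 1ℤ
  sum-isFirst f zero    = ℕₚ.+-identityʳ _
  sum-isFirst f (suc n) = trans (cong (f 0ℤ +_) (trans
    (cong sum (Listₚ.tabulate-cong {n = suc n} (λ i → cong (λ x → f (x ⊖ 0)) (isFirst-inject₁ (opposite i)))))
    (sum-isFirst f n))) (sym (ℕₚ.+-assoc (f 0ℤ) (n * f 0ℤ) (f 1ℤ)))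

  -- Of the 3 + m letters, 1 has weight -1 and k - 1 has weight 1; the letter 0 and the m letters
  -- strictly between have weight 0.
  sum-odd : ∀ (f : ℤ → ℕ) → sum (List.map (λ a → f (odd h a)) (allFin k)) ≡ suc m * f 0ℤ + (f -1ℤ + f 1ℤ)
  sum-odd f = begin
    sum (List.map (λ a → f (odd h a)) (allFin k))
      ≡⟨ cong sum (Listₚ.map-tabulate {n = k} (λ i → i) (λ a → f (odd h a))) ⟩
    f 0ℤ + (f (odd h (F.suc F.zero)) + sum (List.tabulate {n = suc m} (λ i → f (odd h (F.suc (F.suc i))))))
      ≡⟨ cong₂ (λ x y → f 0ℤ + (f (0 ⊖ x) + y)) (cong isFirst (opposite-fromℕ (suc m))) (cong sum (Listₚ.tabulate-cong {n = suc m} tail-value)) ⟩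
    f 0ℤ + (f -1ℤ + sum (List.tabulate {n = suc m} (λ i → f (isFirst (opposite i) ⊖ 0))))
      ≡⟨ cong (λ x → f 0ℤ + (f -1ℤ + x)) (sum-isFirst f m) ⟩
    f 0ℤ + (f -1ℤ + (m * f 0ℤ + f 1ℤ))
      ≡⟨ identity m (f 0ℤ) (f -1ℤ) (f 1ℤ) ⟩
    suc m * f 0ℤ + (f -1ℤ + f 1ℤ) ∎
    where
    open ≡-Reasoning
    identity : ∀ m a b c → a + (b + (m * a + c)) ≡ suc m * a + (b + c)
    identity = solve-∀
    tail-value : ∀ (i : Fin (suc m)) → f (odd h (F.suc (F.suc i))) ≡ f (isFirst (opposite i) ⊖ 0)
    tail-value i = cong₂ (λ x y → f (x ⊖ y)) (isFirst-inject₁ (opposite i))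
      (cong isFirst (Fₚ.opposite-involutive (F.suc i)))

  count : ℕ → ℤ → ℕ
  count n c = length (filter (λ v → weight v ℤₚ.≟ c) (strings k n))

  count-suc : ∀ n c → count (suc n) c ≡ suc m * count n c + (count n (c ℤ.+ 1ℤ) + count n (c ℤ.- 1ℤ))
  count-suc n c = begin
    count (suc n) c
      ≡⟨ length-filter-cartesianProductWith (λ v → weight v ℤₚ.≟ c) _∷_ (allFin k) (strings k n) ⟩
    sum (List.map (λ a → length (filter (λ v → odd h a ℤ.+ weight v ℤₚ.≟ c) (strings k n))) (allFin k))
      ≡⟨ cong sum (Listₚ.map-cong (λ a → cong length (Listₚ.filter-≐ _ _ (shift (odd h a)) (strings k n))) (allFin k)) ⟩
    sum (List.map (λ a → count n (c ℤ.- odd h a)) (allFin k))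
      ≡⟨ sum-odd (λ z → count n (c ℤ.- z)) ⟩
    suc m * count n (c ℤ.- 0ℤ) + (count n (c ℤ.+ 1ℤ) + count n (c ℤ.- 1ℤ))
      ≡⟨ cong (λ x → suc m * count n x + (count n (c ℤ.+ 1ℤ) + count n (c ℤ.- 1ℤ))) (ℤₚ.+-identityʳ c) ⟩
    suc m * count n c + (count n (c ℤ.+ 1ℤ) + count n (c ℤ.- 1ℤ)) ∎
    where
    open ≡-Reasoning
    shift : ∀ z → (∀ {v : Vec (Fin k) n} → z ℤ.+ weight v ≡ c → weight v ≡ c ℤ.- z) ×
                  (∀ {v : Vec (Fin k) n} → weight v ≡ c ℤ.- z → z ℤ.+ weight v ≡ c)
    shift z = (λ {v} e → trans (sym (cancel (weight v))) (cong (ℤ._- z) e)) ,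
              (λ {v} e → trans (cong (λ x → z ℤ.+ x) e) (trans (sym (ℤₚ.+-assoc z c (ℤ.- z))) (cancel c)))
      where
      cancel : ∀ x → (z ℤ.+ x) ℤ.- z ≡ x
      cancel x = trans (cong (ℤ._- z) (ℤₚ.+-comm z x)) (trans (ℤₚ.+-assoc x z (ℤ.- z))
        (trans (cong (λ y → x ℤ.+ y) (ℤₚ.+-inverseʳ z)) (ℤₚ.+-identityʳ x)))

  -- The distribution of the weight is symmetric, so its recurrence over ℤ folds along c ↦ -c. At c
  -- = 0 both neighbours fold onto 1, whence the factor 2 in `trinomial`.
  count≡trinomial : ∀ n c → count n c ≡ trinomial m n ℤ.∣ c ∣
  count≡trinomial zero (ℤ.+ zero)  = refl
  count≡trinomial zero ℤ.+[1+ j ]  = refl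
  count≡trinomial zero -[1+ j ]    = refl
  count≡trinomial (suc n) c = trans (count-suc n c) (trans
    (cong₂ (λ x y → suc m * x + y) (count≡trinomial n c) (cong₂ _+_ (count≡trinomial n (c ℤ.+ 1ℤ)) (count≡trinomial n (c ℤ.- 1ℤ))))
    (step c))
    where
    t = trinomial m n
    step : ∀ c → suc m * t ℤ.∣ c ∣ + (t ℤ.∣ c ℤ.+ 1ℤ ∣ + t ℤ.∣ c ℤ.- 1ℤ ∣) ≡ trinomial m (suc n) ℤ.∣ c ∣
    step (ℤ.+ zero)      = cong (λ x → suc m * t 0 + (t 1 + x)) (sym (ℕₚ.+-identityʳ (t 1)))
    step ℤ.+[1+ j ]      = cong (λ x → suc m * t (suc j) + x)
      (trans (ℕₚ.+-comm _ (t j)) (cong (λ i → t j + t i) (ℕₚ.+-comm (suc j) 1)))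
    step -[1+ zero ]     = refl
    step -[1+ suc j ]    = cong (λ i → suc m * t (2 + j) + (t (suc j) + t i)) (cong (3 +_) (ℕₚ.+-identityʳ j))

  isFirst≤1 : ∀ {n} (i : Fin n) → isFirst i ≤ 1
  isFirst≤1 F.zero    = s≤s z≤n
  isFirst≤1 (F.suc _) = z≤n

  bounds : ∀ {n L} → 1 ≤ n → IsMaxPeriod n k L →
    2 * L ≤ k ^ n × k ^ n ≤ 2 * L + trinomial m n 0
  bounds {n} {L} 1≤n isMax = proj₁ b , subst (λ x → k ^ n ≤ 2 * L + x) (count≡trinomial n 0ℤ) (proj₂ b)
    where
    last≡1 : h (fromℕ (suc m)) ≡ 1
    last≡1 = cong isFirst (opposite-fromℕ (suc m))
    b = odd-maxPeriod-bounds h (λ i → subst (h i ≤_) (sym last≡1) (isFirst≤1 (opposite i)))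
          (λ _ → z≤n) (subst (0 ℕ.<_) (sym last≡1) (s≤s z≤n)) 1≤n isMax

-- Estimates over ℚ

toℚᵘ-ℕ→ℚ : ∀ a → toℚᵘ (ℕ→ℚ a) ℚᵘ.≃ ℚᵘ.mkℚᵘ (ℤ.+ a) 0
toℚᵘ-ℕ→ℚ a = ℚₚ.toℚᵘ-fromℚᵘ (ℚᵘ.mkℚᵘ (ℤ.+ a) 0)

ℕ→ℚ-+ : ∀ a b → ℕ→ℚ (a + b) ≡ ℕ→ℚ a ℚ.+ ℕ→ℚ b
ℕ→ℚ-+ a b = ℚₚ.toℚᵘ-injective (begin
  toℚᵘ (ℕ→ℚ (a + b))                      ≈⟨ toℚᵘ-ℕ→ℚ (a + b) ⟩
  ℚᵘ.mkℚᵘ (ℤ.+ (a + b)) 0                 ≈⟨ ℚᵘ.*≡* (cong (ℤ._* 1ℤ) (trans (ℤₚ.pos-+ a b)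
                                              (cong₂ ℤ._+_ (sym (ℤₚ.*-identityʳ (ℤ.+ a))) (sym (ℤₚ.*-identityʳ (ℤ.+ b)))))) ⟩
  ℚᵘ.mkℚᵘ (ℤ.+ a) 0 ℚᵘ.+ ℚᵘ.mkℚᵘ (ℤ.+ b) 0 ≈⟨ ℚᵘₚ.+-cong (toℚᵘ-ℕ→ℚ a) (toℚᵘ-ℕ→ℚ b) ⟨
  toℚᵘ (ℕ→ℚ a) ℚᵘ.+ toℚᵘ (ℕ→ℚ b)          ≈⟨ ℚₚ.toℚᵘ-homo-+ (ℕ→ℚ a) (ℕ→ℚ b) ⟨
  toℚᵘ (ℕ→ℚ a ℚ.+ ℕ→ℚ b)                  ∎)
  where open ℚᵘₚ.≃-Reasoning

ℕ→ℚ-* : ∀ a b → ℕ→ℚ (a * b) ≡ ℕ→ℚ a ℚ.* ℕ→ℚ b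
ℕ→ℚ-* a b = ℚₚ.toℚᵘ-injective (begin
  toℚᵘ (ℕ→ℚ (a * b))                      ≈⟨ toℚᵘ-ℕ→ℚ (a * b) ⟩
  ℚᵘ.mkℚᵘ (ℤ.+ (a * b)) 0                 ≈⟨ ℚᵘ.*≡* (cong (ℤ._* 1ℤ) (ℤₚ.pos-* a b)) ⟩
  ℚᵘ.mkℚᵘ (ℤ.+ a) 0 ℚᵘ.* ℚᵘ.mkℚᵘ (ℤ.+ b) 0 ≈⟨ ℚᵘₚ.*-cong (toℚᵘ-ℕ→ℚ a) (toℚᵘ-ℕ→ℚ b) ⟨
  toℚᵘ (ℕ→ℚ a) ℚᵘ.* toℚᵘ (ℕ→ℚ b)          ≈⟨ ℚₚ.toℚᵘ-homo-* (ℕ→ℚ a) (ℕ→ℚ b) ⟨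
  toℚᵘ (ℕ→ℚ a ℚ.* ℕ→ℚ b)                  ∎)
  where open ℚᵘₚ.≃-Reasoning

ℕ→ℚ-nonNeg : ∀ a → ℚ.NonNegative (ℕ→ℚ a)
ℕ→ℚ-nonNeg a = ℚₚ.normalize-nonNeg a 1

0≤ℕ→ℚ : ∀ a → 0ℚ ℚ.≤ ℕ→ℚ a
0≤ℕ→ℚ a = ℚₚ.nonNegative⁻¹ (ℕ→ℚ a) {{ℕ→ℚ-nonNeg a}}

ℕ→ℚ-mono-≤ : ∀ {a b} → a ≤ b → ℕ→ℚ a ℚ.≤ ℕ→ℚ b
ℕ→ℚ-mono-≤ {a} {b} a≤b with d , refl ← ℕₚ.m≤n⇒∃[o]m+o≡n a≤b = begin
  ℕ→ℚ a              ≡⟨ ℚₚ.+-identityʳ (ℕ→ℚ a) ⟨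
  ℕ→ℚ a ℚ.+ 0ℚ       ≤⟨ ℚₚ.+-monoʳ-≤ (ℕ→ℚ a) (0≤ℕ→ℚ d) ⟩
  ℕ→ℚ a ℚ.+ ℕ→ℚ d    ≡⟨ ℕ→ℚ-+ a d ⟨
  ℕ→ℚ (a + d)        ∎
  where open ℚₚ.≤-Reasoning

ℕ→ℚ-mono-< : ∀ {a b} → a ℕ.< b → ℕ→ℚ a ℚ.< ℕ→ℚ b
ℕ→ℚ-mono-< {a} {b} a<b = ℚₚ.<-≤-trans (begin-strict
  ℕ→ℚ a              ≡⟨ ℚₚ.+-identityˡ (ℕ→ℚ a) ⟨
  0ℚ ℚ.+ ℕ→ℚ a       <⟨ ℚₚ.+-monoˡ-< (ℕ→ℚ a) (ℚₚ.positive⁻¹ 1ℚ) ⟩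
  1ℚ ℚ.+ ℕ→ℚ a       ≡⟨ ℕ→ℚ-+ 1 a ⟨
  ℕ→ℚ (suc a)        ∎) (ℕ→ℚ-mono-≤ a<b)
  where open ℚₚ.≤-Reasoning

∣ℕ→ℚ∣ : ∀ a → ∣ ℕ→ℚ a ∣ ≡ ℕ→ℚ a
∣ℕ→ℚ∣ a = ℚₚ.0≤p⇒∣p∣≡p (0≤ℕ→ℚ a)

ℕ→ℚ-pred : ∀ {a} → 1 ≤ a → ℕ→ℚ a ℚ.- 1ℚ ≡ ℕ→ℚ (a ∸ 1)
ℕ→ℚ-pred {suc a} _ = trans (cong (ℚ._- 1ℚ) (ℕ→ℚ-+ 1 a))
  (solve 1 (λ x → (con 1ℚ :+ x) :- con 1ℚ := x) refl (ℕ→ℚ a))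
  where open +-*-Solver

ℕ→ℚ-inverse : ∀ l → ℕ→ℚ (suc l) ℚ.* (ℤ.+ 1 ℚ./ suc l) ≡ 1ℚ
ℕ→ℚ-inverse l = ℚₚ.toℚᵘ-injective (begin
  toℚᵘ (ℕ→ℚ (suc l) ℚ.* (ℤ.+ 1 ℚ./ suc l))            ≈⟨ ℚₚ.toℚᵘ-homo-* (ℕ→ℚ (suc l)) (ℤ.+ 1 ℚ./ suc l) ⟩
  toℚᵘ (ℕ→ℚ (suc l)) ℚᵘ.* toℚᵘ (ℤ.+ 1 ℚ./ suc l)      ≈⟨ ℚᵘₚ.*-cong (toℚᵘ-ℕ→ℚ (suc l)) (ℚₚ.toℚᵘ-fromℚᵘ (ℚᵘ.mkℚᵘ 1ℤ l)) ⟩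
  ℚᵘ.mkℚᵘ (ℤ.+ suc l) 0 ℚᵘ.* ℚᵘ.mkℚᵘ 1ℤ l             ≈⟨ ℚᵘ.*≡* (cong ℤ.+_ (identity l)) ⟩
  toℚᵘ 1ℚ                                             ∎)
  where
  open ℚᵘₚ.≃-Reasoning
  identity : ∀ l → (suc l * 1) * 1 ≡ 1 * (1 * suc l)
  identity = solve-∀

-- For ε = (a + 1)/(d + 1) the denominator d + 1 will do, as its product with ε is a + 1.
archimedean : ∀ ε → 0ℚ ℚ.< ε → ∃[ q ] 1ℚ ℚ.≤ ℕ→ℚ (suc q) ℚ.* ε
archimedean (mkℚ (ℤ.+ zero) d c)  0<ε = ⊥-elim (ℚₚ.<-irrefl refl (ℚₚ.<-≤-trans 0<ε (ℚ.*≤* (ℤₚ.≤-reflexive refl))))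
archimedean (mkℚ ℤ.-[1+ a ] d c)  0<ε with () ← ℚ.positive 0<ε
archimedean ε@(mkℚ ℤ.+[1+ a ] d c) 0<ε = d , ℚₚ.toℚᵘ-cancel-≤ (begin
  toℚᵘ 1ℚ                                              ≤⟨ ℚᵘ.*≤* (ℤ.+≤+ bound) ⟩
  ℚᵘ.mkℚᵘ (ℤ.+ suc d) 0 ℚᵘ.* toℚᵘ ε                    ≃⟨ ℚᵘₚ.*-congʳ {toℚᵘ ε} (toℚᵘ-ℕ→ℚ (suc d)) ⟨
  toℚᵘ (ℕ→ℚ (suc d)) ℚᵘ.* toℚᵘ ε                       ≃⟨ ℚₚ.toℚᵘ-homo-* (ℕ→ℚ (suc d)) ε ⟨
  toℚᵘ (ℕ→ℚ (suc d) ℚ.* ε)                             ∎)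
  where
  open ℚᵘₚ.≤-Reasoning
  bound : 1 * (1 * suc d) ≤ (suc d * suc a) * 1
  bound = subst₂ _≤_ (sym (trans (ℕₚ.*-identityˡ _) (ℕₚ.*-identityˡ (suc d)))) (sym (ℕₚ.*-identityʳ _)) (ℕₚ.m≤m*n (suc d) (suc a))

-- With r = x/L - 1 one has 2L r = (2x - K) + (K - 2L), so |r| ≤ (B + Z)/(2L), which `small` makes
-- less than 1/q ≤ ε. Everything is multiplied by 2L q to avoid division.
ratio-close : ∀ {x ε K Z B q L} → 1ℚ ℚ.≤ ℕ→ℚ q ℚ.* ε → ∣ ℕ→ℚ 2 ℚ.* x ℚ.- ℕ→ℚ K ∣ ℚ.≤ ℕ→ℚ B →
  0 ℕ.< L → 2 * L ≤ K → K ≤ 2 * L + Z → q * (Z + B) ℕ.< 2 * L → ∣ ratio x L ℚ.- 1ℚ ∣ ℚ.< ε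
ratio-close {x} {ε} {K} {Z} {B} {q} {suc l} 1≤qε x≈K _ 2L≤K K≤2L+Z small
  with d , refl ← ℕₚ.m≤n⇒∃[o]m+o≡n 2L≤K =
  ℚₚ.*-cancelˡ-<-nonNeg (ι q ℚ.* ι (2 * L)) {{ nonNeg }} (begin-strict
    (ι q ℚ.* ι (2 * L)) ℚ.* ∣ r ∣      ≡⟨ ℚₚ.*-assoc (ι q) (ι (2 * L)) ∣ r ∣ ⟩
    ι q ℚ.* (ι (2 * L) ℚ.* ∣ r ∣)      ≤⟨ ℚₚ.*-monoˡ-≤-nonNeg (ι q) {{ℕ→ℚ-nonNeg q}} scaled ⟩
    ι q ℚ.* ι (Z + B)                  ≡⟨ ℕ→ℚ-* q (Z + B) ⟨
    ι (q * (Z + B))                    <⟨ ℕ→ℚ-mono-< small ⟩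
    ι (2 * L)                          ≡⟨ ℚₚ.*-identityʳ (ι (2 * L)) ⟨
    ι (2 * L) ℚ.* 1ℚ                   ≤⟨ ℚₚ.*-monoˡ-≤-nonNeg (ι (2 * L)) {{ℕ→ℚ-nonNeg (2 * L)}} 1≤qε ⟩
    ι (2 * L) ℚ.* (ι q ℚ.* ε)          ≡⟨ solve 3 (λ a b c → a :* (b :* c) := (b :* a) :* c) refl (ι (2 * L)) (ι q) ε ⟩
    (ι q ℚ.* ι (2 * L)) ℚ.* ε          ∎)
  where
  open ℚₚ.≤-Reasoning
  open +-*-Solver
  ι = ℕ→ℚ
  L = suc l
  r = ratio x L ℚ.- 1ℚ
  L⁻¹ = ℤ.+ 1 ℚ./ L

  nonNeg : ℚ.NonNegative (ι q ℚ.* ι (2 * L))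
  nonNeg = subst ℚ.NonNegative (ℕ→ℚ-* q (2 * L)) (ℕ→ℚ-nonNeg (q * (2 * L)))

  d≤Z : d ≤ Z
  d≤Z = ℕₚ.+-cancelˡ-≤ (2 * L) d Z K≤2L+Z

  cleared : ι (2 * L) ℚ.* r ≡ (ι 2 ℚ.* x ℚ.- ι (2 * L + d)) ℚ.+ ι d
  cleared = begin-equality
    ι (2 * L) ℚ.* (x ℚ.* L⁻¹ ℚ.- 1ℚ)
      ≡⟨ cong (ℚ._* (x ℚ.* L⁻¹ ℚ.- 1ℚ)) (ℕ→ℚ-* 2 L) ⟩
    (ι 2 ℚ.* ι L) ℚ.* (x ℚ.* L⁻¹ ℚ.- 1ℚ)
      ≡⟨ solve 4 (λ t a x b → (t :* a) :* (x :* b :- con 1ℚ) := t :* x :* (a :* b) :- t :* a) refl (ι 2) (ι L) x L⁻¹ ⟩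
    ι 2 ℚ.* x ℚ.* (ι L ℚ.* L⁻¹) ℚ.- ι 2 ℚ.* ι L
      ≡⟨ cong₂ (λ u w → ι 2 ℚ.* x ℚ.* u ℚ.- w) (ℕ→ℚ-inverse l) (sym (ℕ→ℚ-* 2 L)) ⟩
    ι 2 ℚ.* x ℚ.* 1ℚ ℚ.- ι (2 * L)
      ≡⟨ solve 4 (λ t x a e → t :* x :* con 1ℚ :- a := (t :* x :- (a :+ e)) :+ e) refl (ι 2) x (ι (2 * L)) (ι d) ⟩
    (ι 2 ℚ.* x ℚ.- (ι (2 * L) ℚ.+ ι d)) ℚ.+ ι d
      ≡⟨ cong (λ u → (ι 2 ℚ.* x ℚ.- u) ℚ.+ ι d) (ℕ→ℚ-+ (2 * L) d) ⟨
    (ι 2 ℚ.* x ℚ.- ι (2 * L + d)) ℚ.+ ι d ∎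

  scaled : ι (2 * L) ℚ.* ∣ r ∣ ℚ.≤ ι (Z + B)
  scaled = begin
    ι (2 * L) ℚ.* ∣ r ∣                            ≡⟨ cong (ℚ._* ∣ r ∣) (∣ℕ→ℚ∣ (2 * L)) ⟨
    ∣ ι (2 * L) ∣ ℚ.* ∣ r ∣                        ≡⟨ ℚₚ.∣p*q∣≡∣p∣*∣q∣ (ι (2 * L)) r ⟨
    ∣ ι (2 * L) ℚ.* r ∣                            ≡⟨ cong ∣_∣ cleared ⟩
    ∣ (ι 2 ℚ.* x ℚ.- ι (2 * L + d)) ℚ.+ ι d ∣      ≤⟨ ℚₚ.∣p+q∣≤∣p∣+∣q∣ (ι 2 ℚ.* x ℚ.- ι (2 * L + d)) (ι d) ⟩
    ∣ ι 2 ℚ.* x ℚ.- ι (2 * L + d) ∣ ℚ.+ ∣ ι d ∣    ≤⟨ ℚₚ.+-mono-≤ x≈K (ℚₚ.≤-reflexive (∣ℕ→ℚ∣ d)) ⟩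
    ι B ℚ.+ ι d                                    ≡⟨ ℕ→ℚ-+ B d ⟨
    ι (B + d)                                      ≤⟨ ℕ→ℚ-mono-≤ (ℕₚ.≤-trans (ℕₚ.+-monoʳ-≤ B d≤Z) (ℕₚ.≤-reflexive (ℕₚ.+-comm B Z))) ⟩
    ι (Z + B)                                      ∎

oddPartAux≤ : ∀ f x → oddPartAux f x ≤ x
oddPartAux≤ zero    x = ℕₚ.≤-refl
oddPartAux≤ (suc f) x with (x % 2 ℕ.≡ᵇ 0) ∧ (0 ℕ.<ᵇ x)
... | true  = ℕₚ.≤-trans (oddPartAux≤ f (x / 2)) (m/n≤m x 2)
... | false = ℕₚ.≤-refl

δ≤2 : ∀ k → δ k ≤ 2
δ≤2 k with isOdd k
... | true  = s≤s z≤n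
... | false = ℕₚ.≤-refl

double-half : ∀ y → ℕ→ℚ 2 ℚ.* (y ℚ.* ½) ≡ y
double-half y = trans (solve 3 (λ t y h → t :* (y :* h) := (t :* h) :* y) refl (ℕ→ℚ 2) y ½) (ℚₚ.*-identityˡ y)
  where open +-*-Solver

-- Distance between 2 s_k and k^n

module _ {k : ℕ} (3≤k : 3 ≤ k) where

  private
    instance
      k≢0 : ℕ.NonZero k
      k≢0 = ℕ.>-nonZero (ℕₚ.≤-trans (s≤s z≤n) 3≤k)

    1≤k^ : ∀ e → 1 ≤ k ^ e
    1≤k^ e = ℕₚ.m^n>0 k e

  -- The 9 is 3 + 2 + 2 + 2, one summand for each of the four corrections when n is even. There
  -- k^((n - 2)/2) comes with a factor δ² + k ≤ 3k, which raises the exponent to n/2.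
  errorBound : ℕ → ℕ
  errorBound n = 9 * (n * k ^ (n / 2))

  odd-error : ∀ {n} → 1 ≤ n → δ k * (n * (k ^ ((n ∸ 1) / 2) ∸ 1) + 1) ≤ errorBound n
  odd-error {n} 1≤n = begin
    δ k * (n * (h ∸ 1) + 1)   ≤⟨ ℕₚ.*-mono-≤ (ℕₚ.≤-trans (δ≤2 k) (ℕₚ.m≤m+n 2 7)) (ℕₚ.+-monoʳ-≤ (n * (h ∸ 1)) 1≤n) ⟩
    9 * (n * (h ∸ 1) + n)     ≡⟨ cong (9 *_) (trans (ℕₚ.+-comm _ n) (sym (ℕₚ.*-suc n (h ∸ 1)))) ⟩
    9 * (n * suc (h ∸ 1))     ≡⟨ cong (λ x → 9 * (n * x)) (ℕₚ.m+[n∸m]≡n (1≤k^ ((n ∸ 1) / 2))) ⟩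
    9 * (n * h)               ≤⟨ ℕₚ.*-monoʳ-≤ 9 (ℕₚ.*-monoʳ-≤ n (ℕₚ.^-monoʳ-≤ k (/-monoˡ-≤ 2 (ℕₚ.m∸n≤m n 1)))) ⟩
    errorBound n              ∎
    where
    open ℕₚ.≤-Reasoning
    h = k ^ ((n ∸ 1) / 2)

  even-error : ∀ {n} → 2 ≤ n → let m = oddPart n; p = k ^ ((m ∸ 1) / 2) in
    n * k ^ ((n ∸ 2) / 2) * (δ k * δ k + k) + n * δ k * p + m * δ k * (p ∸ 1) + δ k ≤ errorBound n
  even-error {n} 2≤n = begin
    n * h * (δ k * δ k + k) + n * δ k * p + m * δ k * (p ∸ 1) + δ k
      ≤⟨ ℕₚ.+-mono-≤ (ℕₚ.+-mono-≤ (ℕₚ.+-mono-≤ (ℕₚ.*-monoʳ-≤ (n * h) δ²+k≤3k)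
           (ℕₚ.*-mono-≤ (ℕₚ.*-monoʳ-≤ n (δ≤2 k)) p≤H))
           (ℕₚ.*-mono-≤ (ℕₚ.*-mono-≤ m≤n (δ≤2 k)) (ℕₚ.≤-trans (ℕₚ.m∸n≤m p 1) p≤H)))
           (ℕₚ.≤-trans (δ≤2 k) (ℕₚ.*-monoʳ-≤ 2 (ℕₚ.*-mono-≤ (ℕₚ.≤-trans (s≤s z≤n) 2≤n) (1≤k^ (n / 2))))) ⟩
    n * h * (3 * k) + n * 2 * H + n * 2 * H + 2 * (n * H)
      ≡⟨ cong (λ x → x + n * 2 * H + n * 2 * H + 2 * (n * H)) (trans (regroup n h k) (cong (λ x → 3 * (n * x)) k*h≡H)) ⟩
    3 * (n * H) + n * 2 * H + n * 2 * H + 2 * (n * H)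
      ≡⟨ collect n H ⟩
    9 * (n * H) ∎
    where
    open ℕₚ.≤-Reasoning
    m = oddPart n
    p = k ^ ((m ∸ 1) / 2)
    h = k ^ ((n ∸ 2) / 2)
    H = k ^ (n / 2)
    m≤n : m ≤ n
    m≤n = oddPartAux≤ n n
    p≤H : p ≤ H
    p≤H = ℕₚ.^-monoʳ-≤ k (/-monoˡ-≤ 2 (ℕₚ.≤-trans (ℕₚ.m∸n≤m m 1) m≤n))
    k*h≡H : k * h ≡ H
    k*h≡H = cong (k ^_) (sym (m/n≡1+[m∸n]/n 2≤n))
    δ²+k≤3k : δ k * δ k + k ≤ 3 * k
    δ²+k≤3k = begin
      δ k * δ k + k   ≤⟨ ℕₚ.+-monoˡ-≤ k (ℕₚ.*-mono-≤ (δ≤2 k) (δ≤2 k)) ⟩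
      4 + k           ≤⟨ ℕₚ.+-monoˡ-≤ k (ℕₚ.≤-trans (ℕₚ.m≤m+n 4 2) (ℕₚ.*-monoʳ-≤ 2 3≤k)) ⟩
      2 * k + k       ≡⟨ ℕₚ.+-comm (2 * k) k ⟩
      3 * k           ∎
    regroup : ∀ n h k → n * h * (3 * k) ≡ 3 * (n * (k * h))
    regroup = solve-∀
    collect : ∀ n H → 3 * (n * H) + n * 2 * H + n * 2 * H + 2 * (n * H) ≡ 9 * (n * H)
    collect = solve-∀

  -- For odd n a single correction is subtracted. For even n the corrections have mixed signs, so
  -- the triangle inequality adds their absolute values, and the halved one is bounded by its
  -- double.
  sK-error : ∀ {n} → 3 ≤ n → ∣ ℕ→ℚ 2 ℚ.* sK n k ℚ.- ℕ→ℚ (k ^ n) ∣ ℚ.≤ ℕ→ℚ (errorBound n)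
  sK-error {n} 3≤n with isOdd n
  ... | true = begin
    ∣ ι 2 ℚ.* (E ℚ.* ½) ℚ.- ι (k ^ n) ∣
      ≡⟨ cong (λ x → ∣ x ℚ.- ι (k ^ n) ∣) (double-half E) ⟩
    ∣ (ι (k ^ n) ℚ.- ι (δ k) ℚ.* (ι n ℚ.* (ι h ℚ.- 1ℚ) ℚ.+ 1ℚ)) ℚ.- ι (k ^ n) ∣
      ≡⟨ cong (λ x → ∣ (ι (k ^ n) ℚ.- ι (δ k) ℚ.* (ι n ℚ.* x ℚ.+ 1ℚ)) ℚ.- ι (k ^ n) ∣) (ℕ→ℚ-pred (1≤k^ ((n ∸ 1) / 2))) ⟩
    ∣ (ι (k ^ n) ℚ.- ι (δ k) ℚ.* (ι n ℚ.* ι (h ∸ 1) ℚ.+ 1ℚ)) ℚ.- ι (k ^ n) ∣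
      ≡⟨ cong ∣_∣ (solve 2 (λ a b → (a :- b) :- a := :- b) refl (ι (k ^ n)) (ι (δ k) ℚ.* (ι n ℚ.* ι (h ∸ 1) ℚ.+ 1ℚ))) ⟩
    ∣ ℚ.- (ι (δ k) ℚ.* (ι n ℚ.* ι (h ∸ 1) ℚ.+ 1ℚ)) ∣
      ≡⟨ ℚₚ.∣-p∣≡∣p∣ _ ⟩
    ∣ ι (δ k) ℚ.* (ι n ℚ.* ι (h ∸ 1) ℚ.+ 1ℚ) ∣
      ≡⟨ cong ∣_∣ (trans (cong (ι (δ k) ℚ.*_) (trans (cong (ℚ._+ 1ℚ) (sym (ℕ→ℚ-* n (h ∸ 1)))) (sym (ℕ→ℚ-+ (n * (h ∸ 1)) 1))))
           (sym (ℕ→ℚ-* (δ k) (n * (h ∸ 1) + 1)))) ⟩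
    ∣ ι (δ k * (n * (h ∸ 1) + 1)) ∣
      ≡⟨ ∣ℕ→ℚ∣ (δ k * (n * (h ∸ 1) + 1)) ⟩
    ι (δ k * (n * (h ∸ 1) + 1))
      ≤⟨ ℕ→ℚ-mono-≤ (odd-error (ℕₚ.≤-trans (s≤s z≤n) 3≤n)) ⟩
    ι (errorBound n) ∎
    where
    open ℚₚ.≤-Reasoning
    open +-*-Solver
    ι = ℕ→ℚ
    h = k ^ ((n ∸ 1) / 2)
    E = ι (k ^ n) ℚ.- ι (δ k) ℚ.* (ι n ℚ.* (ι h ℚ.- 1ℚ) ℚ.+ 1ℚ)
  ... | false = begin
    ∣ ι 2 ℚ.* (E ℚ.* ½) ℚ.- ι (k ^ n) ∣
      ≡⟨ cong (λ x → ∣ x ℚ.- ι (k ^ n) ∣) (double-half E) ⟩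
    ∣ (ι (k ^ n) ℚ.- (ι n ℚ.* ι h ℚ.* ½) ℚ.* (ι (δ k * δ k) ℚ.+ ι k) ℚ.+ ι n ℚ.* ι (δ k) ℚ.* ι p
        ℚ.- ι m ℚ.* ι (δ k) ℚ.* (ι p ℚ.- 1ℚ) ℚ.- ι (δ k)) ℚ.- ι (k ^ n) ∣
      ≡⟨ cong ∣_∣ (trans (cong₂ (λ b c →
            (ι (k ^ n) ℚ.- (ι n ℚ.* ι h ℚ.* ½) ℚ.* (ι (δ k * δ k) ℚ.+ ι k) ℚ.+ b ℚ.- c ℚ.- ι (δ k)) ℚ.- ι (k ^ n)) B≡ C≡)
          (trans (cong (λ x → (ι (k ^ n) ℚ.- x ℚ.+ ι B ℚ.- ι C ℚ.- ι (δ k)) ℚ.- ι (k ^ n)) A≡)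
            (solve 5 (λ K a b c d → (K :- a :+ b :- c :- d) :- K := ((:- a :+ b) :- c) :- d) refl
              (ι (k ^ n)) (ι A ℚ.* ½) (ι B) (ι C) (ι (δ k))))) ⟩
    ∣ ((ℚ.- (ι A ℚ.* ½) ℚ.+ ι B) ℚ.- ι C) ℚ.- ι (δ k) ∣
      ≤⟨ ℚₚ.≤-trans (ℚₚ.∣p-q∣≤∣p∣+∣q∣ ((ℚ.- (ι A ℚ.* ½) ℚ.+ ι B) ℚ.- ι C) (ι (δ k)))
          (ℚₚ.+-mono-≤ (ℚₚ.≤-trans (ℚₚ.∣p-q∣≤∣p∣+∣q∣ (ℚ.- (ι A ℚ.* ½) ℚ.+ ι B) (ι C))
            (ℚₚ.+-mono-≤ (ℚₚ.≤-trans (ℚₚ.∣p+q∣≤∣p∣+∣q∣ (ℚ.- (ι A ℚ.* ½)) (ι B))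
              (ℚₚ.+-mono-≤ half≤ (ℚₚ.≤-reflexive (∣ℕ→ℚ∣ B)))) (ℚₚ.≤-reflexive (∣ℕ→ℚ∣ C)))) (ℚₚ.≤-reflexive (∣ℕ→ℚ∣ (δ k)))) ⟩
    ((ι A ℚ.+ ι B) ℚ.+ ι C) ℚ.+ ι (δ k)
      ≡⟨ trans (cong (λ x → (x ℚ.+ ι C) ℚ.+ ι (δ k)) (sym (ℕ→ℚ-+ A B)))
          (trans (cong (ℚ._+ ι (δ k)) (sym (ℕ→ℚ-+ (A + B) C))) (sym (ℕ→ℚ-+ (A + B + C) (δ k)))) ⟩
    ι (A + B + C + δ k)
      ≤⟨ ℕ→ℚ-mono-≤ (even-error (ℕₚ.≤-trans (s≤s (s≤s z≤n)) 3≤n)) ⟩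
    ι (errorBound n) ∎
    where
    open ℚₚ.≤-Reasoning
    open +-*-Solver
    ι = ℕ→ℚ
    m = oddPart n
    p = k ^ ((m ∸ 1) / 2)
    h = k ^ ((n ∸ 2) / 2)
    A = n * h * (δ k * δ k + k)
    B = n * δ k * p
    C = m * δ k * (p ∸ 1)
    E = ι (k ^ n) ℚ.- (ι n ℚ.* ι h ℚ.* ½) ℚ.* (ι (δ k * δ k) ℚ.+ ι k) ℚ.+ ι n ℚ.* ι (δ k) ℚ.* ι p
        ℚ.- ι m ℚ.* ι (δ k) ℚ.* (ι p ℚ.- 1ℚ) ℚ.- ι (δ k)

    ℕ→ℚ-*₃ : ∀ a b c → ι a ℚ.* ι b ℚ.* ι c ≡ ι (a * b * c)
    ℕ→ℚ-*₃ a b c = trans (cong (ℚ._* ι c) (sym (ℕ→ℚ-* a b))) (sym (ℕ→ℚ-* (a * b) c))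

    A≡ : (ι n ℚ.* ι h ℚ.* ½) ℚ.* (ι (δ k * δ k) ℚ.+ ι k) ≡ ι A ℚ.* ½
    A≡ = trans (cong ((ι n ℚ.* ι h ℚ.* ½) ℚ.*_) (sym (ℕ→ℚ-+ (δ k * δ k) k)))
      (trans (solve 4 (λ a b c d → (a :* b :* c) :* d := (a :* b :* d) :* c) refl (ι n) (ι h) ½ (ι (δ k * δ k + k)))
        (cong (ℚ._* ½) (ℕ→ℚ-*₃ n h (δ k * δ k + k))))

    B≡ : ι n ℚ.* ι (δ k) ℚ.* ι p ≡ ι B
    B≡ = ℕ→ℚ-*₃ n (δ k) p

    C≡ : ι m ℚ.* ι (δ k) ℚ.* (ι p ℚ.- 1ℚ) ≡ ι C
    C≡ = trans (cong (ι m ℚ.* ι (δ k) ℚ.*_) (ℕ→ℚ-pred (1≤k^ ((m ∸ 1) / 2)))) (ℕ→ℚ-*₃ m (δ k) (p ∸ 1))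

    half≤ : ∣ ℚ.- (ι A ℚ.* ½) ∣ ℚ.≤ ι A
    half≤ = begin
      ∣ ℚ.- (ι A ℚ.* ½) ∣   ≡⟨ trans (ℚₚ.∣-p∣≡∣p∣ (ι A ℚ.* ½)) (trans (ℚₚ.∣p*q∣≡∣p∣*∣q∣ (ι A) ½) (cong (ℚ._* ½) (∣ℕ→ℚ∣ A))) ⟩
      ι A ℚ.* ½             ≤⟨ ℚₚ.*-monoˡ-≤-nonNeg (ι A) {{ℕ→ℚ-nonNeg A}} (ℚ.*≤* (ℤ.+≤+ (s≤s z≤n))) ⟩
      ι A ℚ.* 1ℚ            ≡⟨ ℚₚ.*-identityʳ (ι A) ⟩
      ι A                   ∎

-- The two limits

-- In 2 + q, the multiple q + 1 is what `ratio-close` asks of Z + B, and one more Z pays for passing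
-- from K to 2L. The outer 2 gives half of K to each of Z and B.
ratio-error : ∀ {x ε q K Z B L} → 1ℚ ℚ.≤ ℕ→ℚ (suc q) ℚ.* ε →
  ∣ ℕ→ℚ 2 ℚ.* x - ℕ→ℚ K ∣ ℚ.≤ ℕ→ℚ B →
  0 ℕ.< L → 2 * L ≤ K × K ≤ 2 * L + Z → 2 * (2 + q) * Z ≤ K → 2 * (2 + q) * B ℕ.< K →
  ∣ ratio x L - 1ℚ ∣ < ε
ratio-error {q = q} {K} {Z} {B} {L} 1≤qε x≈K 0<L (2L≤K , K≤2L+Z) Z≤ B< =
  ratio-close {Z = Z} {B} {suc q} {L} 1≤qε x≈K 0<L 2L≤K K≤2L+Z (ℕₚ.+-cancelʳ-< Z (suc q * (Z + B)) (2 * L)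
    (ℕₚ.*-cancelˡ-< 2 (suc q * (Z + B) + Z) (2 * L + Z) (begin-strict
      2 * (suc q * (Z + B) + Z)                     ≤⟨ ℕₚ.m≤m+n _ (2 * B) ⟩
      2 * (suc q * (Z + B) + Z) + 2 * B             ≡⟨ identity q Z B ⟩
      2 * (2 + q) * Z + 2 * (2 + q) * B             <⟨ ℕₚ.+-mono-≤-< Z≤ B< ⟩
      K + K                                         ≤⟨ ℕₚ.+-mono-≤ K≤2L+Z K≤2L+Z ⟩
      (2 * L + Z) + (2 * L + Z)                     ≡⟨ cong ((2 * L + Z) +_) (ℕₚ.+-identityʳ (2 * L + Z)) ⟨
      2 * (2 * L + Z)                               ∎)))
  where
  open ℕₚ.≤-Reasoning
  identity : ∀ q z b → 2 * (suc q * (z + b) + z) + 2 * b ≡ 2 * (2 + q) * z + 2 * (2 + q) * b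
  identity = solve-∀

maxPeriod-pos : ∀ {n k L} → IsMaxPeriod n k L → 0 ℕ.< L
maxPeriod-pos ((_ , (_ , (0<L , _) , _)) , _) = 0<L

n/2≤ : ∀ n → n / 2 + n / 2 ≤ n
n/2≤ n = ℕₚ.≤-trans
  (ℕₚ.≤-reflexive (trans (cong (n / 2 +_) (sym (ℕₚ.+-identityʳ (n / 2)))) (ℕₚ.*-comm 2 (n / 2)))) (m/n*n≤m n 2)

k-limit : (n : ℕ) → 3 ≤ n → (ε : ℚ) → 0ℚ < ε →
  ∃[ K ] ((k : ℕ) → 3 ≤ k → K ≤ k → (L : ℕ) → IsMaxPeriod n k L → ∣ ratio (sK n k) L - 1ℚ ∣ < ε)
-- Such a k exceeds the whole coefficient of k^(n/2) in the scaled error, and k^(1 + n/2) ≤ k^n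
-- because n/2 ≥ 1. It also exceeds the coefficient of k^(n - 1) in the scaled ties, as 2 ≤ 9n.
k-limit n@(suc n-1) 3≤n ε 0<ε with q , 1≤qε ← archimedean ε 0<ε = suc (2 * (2 + q) * (9 * n)) , limit
  where
  limit : (k : ℕ) → 3 ≤ k → suc (2 * (2 + q) * (9 * n)) ≤ k →
    (L : ℕ) → IsMaxPeriod n k L → ∣ ratio (sK n k) L - 1ℚ ∣ < ε
  limit (suc zero) (s≤s ())
  limit k@(suc (suc r)) 3≤k large L isMax =
    ratio-error {q = q} {B = errorBound 3≤k n} 1≤qε (sK-error 3≤k 3≤n) (maxPeriod-pos isMax)
      (LinearWeight.bounds r (ℕ.s≤s⁻¹ (ℕ.s≤s⁻¹ 3≤k)) isMax) ties-small error-small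
    where
    open ℕₚ.≤-Reasoning
    ties-small : 2 * (2 + q) * (2 * k ^ n-1) ≤ k ^ n
    ties-small = begin
      2 * (2 + q) * (2 * k ^ n-1)   ≡⟨ ℕₚ.*-assoc (2 * (2 + q)) 2 (k ^ n-1) ⟨
      2 * (2 + q) * 2 * k ^ n-1     ≤⟨ ℕₚ.*-monoˡ-≤ (k ^ n-1) (ℕₚ.≤-trans (ℕₚ.*-monoʳ-≤ (2 * (2 + q))
                                        (ℕₚ.≤-trans (ℕₚ.m≤m+n 2 7) (ℕₚ.m≤m*n 9 n))) (ℕₚ.≤-trans (ℕₚ.n≤1+n _) large)) ⟩
      k * k ^ n-1                   ∎
    error-small : 2 * (2 + q) * errorBound 3≤k n ℕ.< k ^ n
    error-small = begin-strict
      2 * (2 + q) * (9 * (n * k ^ (n / 2)))  ≡⟨ identity (2 * (2 + q)) n (k ^ (n / 2)) ⟩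
      2 * (2 + q) * (9 * n) * k ^ (n / 2)    <⟨ ℕₚ.*-monoˡ-< (k ^ (n / 2)) {{ℕₚ.m^n≢0 k (n / 2)}} large ⟩
      k * k ^ (n / 2)                        ≤⟨ ℕₚ.^-monoʳ-≤ k (ℕₚ.≤-trans (ℕₚ.+-monoˡ-≤ (n / 2) 1≤n/2) (n/2≤ n)) ⟩
      k ^ n                                  ∎
      where
      identity : ∀ a b c → a * (9 * (b * c)) ≡ a * (9 * b) * c
      identity = solve-∀
      1≤n/2 : 1 ≤ n / 2
      1≤n/2 = /-monoˡ-≤ 2 (ℕₚ.≤-trans (ℕₚ.n≤1+n 2) 3≤n)

suc≤3^ : ∀ j → suc j ≤ 3 ^ j
suc≤3^ zero    = ℕₚ.≤-refl
suc≤3^ (suc j) = begin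
  suc (suc j)          ≡⟨ ℕₚ.+-comm 1 (suc j) ⟩
  suc j + 1            ≤⟨ ℕₚ.+-mono-≤ (suc≤3^ j) (ℕₚ.≤-trans (ℕₚ.m^n>0 3 j) (ℕₚ.m≤m+n (3 ^ j) _)) ⟩
  3 * 3 ^ j            ∎
  where open ℕₚ.≤-Reasoning

-- Let j be n halved twice. From n < 4 (j + 1) and the 16 in the hypothesis, 4 (c + 1) ≤ j + 1;
-- hence (c + 1) n < (j + 1)^2 ≤ k^(2j), and 2j + n/2 ≤ n.
linear<exponential : ∀ {k} c n → 3 ≤ k → 16 * suc c ≤ n → suc c * (n * k ^ (n / 2)) ℕ.< k ^ n
linear<exponential {k@(suc _)} c n 3≤k large = begin-strict
  suc c * (n * k ^ (n / 2))                     ≡⟨ ℕₚ.*-assoc (suc c) n (k ^ (n / 2)) ⟨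
  suc c * n * k ^ (n / 2)                       <⟨ ℕₚ.*-monoˡ-< (k ^ (n / 2)) {{ℕₚ.m^n≢0 k (n / 2)}} cn<k^2j ⟩
  k ^ (j + j) * k ^ (n / 2)                     ≡⟨ ℕₚ.^-distribˡ-+-* k (j + j) (n / 2) ⟨
  k ^ (j + j + n / 2)                           ≤⟨ ℕₚ.^-monoʳ-≤ k (ℕₚ.≤-trans (ℕₚ.+-monoˡ-≤ (n / 2) (n/2≤ (n / 2))) (n/2≤ n)) ⟩
  k ^ n                                         ∎
  where
  open ℕₚ.≤-Reasoning
  j = (n / 2) / 2
  half< : ∀ x → suc x ≤ 2 * suc (x / 2)
  half< x = begin
    suc x                           ≡⟨ cong suc (m≡m%n+[m/n]*n x 2) ⟩
    suc (x % 2 + x / 2 * 2)         ≤⟨ ℕₚ.+-monoˡ-≤ (x / 2 * 2) (m%n<n x 2) ⟩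
    2 + x / 2 * 2                   ≡⟨ ℕₚ.*-comm (suc (x / 2)) 2 ⟩
    2 * suc (x / 2)                 ∎
  n<4j : n ℕ.< 4 * suc j
  n<4j = begin
    suc n              ≤⟨ half< n ⟩
    2 * suc (n / 2)    ≤⟨ ℕₚ.*-monoʳ-≤ 2 (half< (n / 2)) ⟩
    2 * (2 * suc j)    ≡⟨ ℕₚ.*-assoc 2 2 (suc j) ⟨
    4 * suc j          ∎
  4c≤j : 4 * suc c ≤ suc j
  4c≤j = ℕₚ.<⇒≤ (ℕₚ.*-cancelˡ-< 4 (4 * suc c) (suc j) (begin-strict
    4 * (4 * suc c)   ≡⟨ ℕₚ.*-assoc 4 4 (suc c) ⟨
    16 * suc c        ≤⟨ large ⟩
    n                 <⟨ n<4j ⟩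
    4 * suc j         ∎))
  cn<k^2j : suc c * n ℕ.< k ^ (j + j)
  cn<k^2j = begin-strict
    suc c * n                <⟨ ℕₚ.*-monoʳ-< (suc c) n<4j ⟩
    suc c * (4 * suc j)      ≡⟨ trans (sym (ℕₚ.*-assoc (suc c) 4 (suc j))) (cong (_* suc j) (ℕₚ.*-comm (suc c) 4)) ⟩
    4 * suc c * suc j        ≤⟨ ℕₚ.*-monoˡ-≤ (suc j) 4c≤j ⟩
    suc j * suc j            ≤⟨ ℕₚ.*-mono-≤ (suc≤3^ j) (suc≤3^ j) ⟩
    3 ^ j * 3 ^ j            ≤⟨ ℕₚ.*-mono-≤ (ℕₚ.^-monoˡ-≤ j 3≤k) (ℕₚ.^-monoˡ-≤ j 3≤k) ⟩
    k ^ j * k ^ j            ≡⟨ ℕₚ.^-distribˡ-+-* k j j ⟨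
    k ^ (j + j)              ∎

n-limit : (k : ℕ) → 3 ≤ k → (ε : ℚ) → 0ℚ < ε →
  ∃[ N ] ((n : ℕ) → 3 ≤ n → N ≤ n → (L : ℕ) → IsMaxPeriod n k L → ∣ ratio (sK n k) L - 1ℚ ∣ < ε)
n-limit (suc zero)       (s≤s ())
n-limit (suc (suc zero)) (s≤s (s≤s ()))
-- The first summand is the length after which the ties are few, the second the threshold of
-- `linear<exponential` for the coefficient 2 (2 + q) 9 of the error.
n-limit k@(suc (suc (suc m))) 3≤k ε 0<ε with q , 1≤qε ← archimedean ε 0<ε = Decay.M b * b + 16 * (2 * (2 + q) * 9) , limit
  where
  open Trinomial m
  -- `Low` bounds b + 1 times the ties by 2 k^n, so half of b must be the factor 2 (2 + q) of
  -- `ratio-error`.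
  b = 4 * (2 + q)
  limit : (n : ℕ) → 3 ≤ n → Decay.M b * b + 16 * (2 * (2 + q) * 9) ≤ n →
    (L : ℕ) → IsMaxPeriod n k L → ∣ ratio (sK n k) L - 1ℚ ∣ < ε
  limit n 3≤n N≤n L isMax =
    ratio-error {q = q} {B = errorBound 3≤k n} 1≤qε (sK-error 3≤k 3≤n) (maxPeriod-pos isMax)
      (SignWeight.bounds m (ℕₚ.≤-trans (s≤s z≤n) 3≤n) isMax)
      (ties-small n (Decay.low-eventually b (ℕₚ.m+n≤o⇒m≤o _ N≤n)))
      (ℕₚ.≤-<-trans (ℕₚ.≤-reflexive (sym (ℕₚ.*-assoc (2 * (2 + q)) 9 (n * k ^ (n / 2)))))
        (linear<exponential _ n 3≤k (ℕₚ.m+n≤o⇒n≤o (Decay.M b * b) N≤n)))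
    where
    ties-small : ∀ n → suc b * trinomial m n 0 ≤ 2 * k ^ n → 2 * (2 + q) * trinomial m n 0 ≤ k ^ n
    ties-small n low = ℕₚ.*-cancelˡ-≤ 2 (begin
      2 * (2 * (2 + q) * trinomial m n 0)   ≡⟨ identity q (trinomial m n 0) ⟩
      b * trinomial m n 0                   ≤⟨ ℕₚ.m≤n+m _ (trinomial m n 0) ⟩
      suc b * trinomial m n 0               ≤⟨ low ⟩
      2 * k ^ n                             ∎)
      where
      open ℕₚ.≤-Reasoning
      identity : ∀ q z → 2 * (2 * (2 + q) * z) ≡ 4 * (2 + q) * z
      identity = solve-∀

theorem5p3 : ((k : ℕ) → 3 ≤ k → (ε : ℚ) → 0ℚ < ε →
    ∃[ N ] ((n : ℕ) → 3 ≤ n → N ≤ n → (L : ℕ) → IsMaxPeriod n k L →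
    ∣ ratio (sK n k) L - 1ℚ ∣ < ε))
    ×
    ((n : ℕ) → 3 ≤ n → (ε : ℚ) → 0ℚ < ε →
    ∃[ K ] ((k : ℕ) → 3 ≤ k → K ≤ k → (L : ℕ) → IsMaxPeriod n k L →
    ∣ ratio (sK n k) L - 1ℚ ∣ < ε))
theorem5p3 = n-limit , k-limit
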